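{- Let $G=B(m;R,S,T)$ be a connected bicirculant with $m$ even, $m\ge 4$, $|S|\ge 3$, and $m/2\in R$ and $m/2\in T$. Then $G$ is hamiltonian.
   Context: For an integer $m\ge 1$ and subsets $R,S,T\subseteq\mathbb{Z}_m$ with $R=-R$, $T=-T$, $0\notin R\cup T$, $0\in S$ and $|R|=|T|$, the bicirculant $B(m;R,S,T)$ is the graph with vertex set $\{u_0,\dots,u_{m-1}\}\cup\{v_0,\dots,v_{m-1}\}$ and edge set $\{u_iu_{i+j}: i\in\mathbb{Z}_m, j\in R\}\cup\{v_iv_{i+j}: i\in\mathbb{Z}_m, j\in T\}\cup\{u_iv_{i+j}: i\in\mathbb{Z}_m, j\in S\}$ (indices mod $m$). -}

module Defs where

open import Data.Fin.Base using (Fin; toℕ)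
open import Data.Fin.Properties using (toℕ-injective; toℕ-fromℕ<; toℕ<n)
open import Data.Fin.Subset using (Subset; _∈_; _∉_; ∣_∣)
open import Data.List.Base using (List; _∷_; _∷ʳ_; length)
import Data.List.Membership.Propositional as List
open import Data.List.Relation.Unary.Linked using (Linked)
open import Data.List.Relation.Unary.Unique.Propositional using (Unique)
open import Data.Nat.Base
open import Data.Nat.Divisibility using (divides; n∣m⇒m%n≡0)
open import Data.Nat.DivMod using (_mod_; m≡m%n+[m/n]*n; m<n⇒m%n≡m)
open import Data.Nat.Properties using (+-cancelˡ-≡)
open import Data.Product.Base using (_×_; ∃)
open import Function.Bundles using (_⇔_)
open import Level using (0ℓ)
open import Relation.Binary.Construct.Closure.ReflexiveTransitive using (Star)
open import Relation.Binary.Construct.Closure.Symmetric using (SymClosure; fwd; bwd; symmetric)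
open import Relation.Binary.Core using (Rel)
open import Relation.Binary.Definitions using (Symmetric; Irreflexive)
open import Relation.Binary.PropositionalEquality as ≡
  using (_≡_; _≢_; refl; cong; subst; module ≡-Reasoning)

record Graph : Set₁ where
  field
    Vertex : Set
    Adj    : Rel Vertex 0ℓ
    sym    : Symmetric Adj
    irrefl : Irreflexive _≡_ Adj

module _ (G : Graph) where
  open Graph G

  Connected : Set
  Connected = ∀ x y → Star Adj x y

  -- A cycle is given by its vertices in order, x ∷ xs, without repeating x at the end.
  IsCycle : Vertex → List Vertex → Set
  IsCycle x xs = 3 ≤ length (x ∷ xs) × Unique (x ∷ xs) × Linked Adj (x ∷ xs ∷ʳ x)

  Hamiltonian : Set
  Hamiltonian = ∃ λ x → ∃ λ xs → IsCycle x xs × (∀ y → y List.∈ (x ∷ xs))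

-- ℤₘ is represented by Fin m, with residues 0, …, m - 1.
module _ {m : ℕ} .{{_ : NonZero m}} where

  infixl 6 _⊕_
  infix  8 ⊖_

  _⊕_ : Fin m → Fin m → Fin m
  i ⊕ j = (toℕ i + toℕ j) mod m

  ⊖_ : Fin m → Fin m
  ⊖ i = (m ∸ toℕ i) mod m

  0ₘ : Fin m
  0ₘ = 0 mod m

  i≡i⊕j⇒j≡0 : ∀ i j → i ≡ i ⊕ j → j ≡ 0ₘ
  i≡i⊕j⇒j≡0 i j eq = toℕ-injective (begin
    toℕ j        ≡⟨ m<n⇒m%n≡m (toℕ<n j) ⟨
    toℕ j % m    ≡⟨ n∣m⇒m%n≡0 (toℕ j) m (divides ((toℕ i + toℕ j) / m) j≡q*m) ⟩
    0            ≡⟨ m<n⇒m%n≡m (>-nonZero⁻¹ m) ⟨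
    0 % m        ≡⟨ toℕ-fromℕ< _ ⟨
    toℕ 0ₘ       ∎)
    where
    open ≡-Reasoning
    j≡q*m : toℕ j ≡ (toℕ i + toℕ j) / m * m
    j≡q*m = +-cancelˡ-≡ (toℕ i) _ _ (begin
      toℕ i + toℕ j                                        ≡⟨ m≡m%n+[m/n]*n (toℕ i + toℕ j) m ⟩
      (toℕ i + toℕ j) % m + (toℕ i + toℕ j) / m * m        ≡⟨ cong (_+ (toℕ i + toℕ j) / m * m) (toℕ-fromℕ< _) ⟨
      toℕ (i ⊕ j) + (toℕ i + toℕ j) / m * m                ≡⟨ cong (λ k → toℕ k + (toℕ i + toℕ j) / m * m) eq ⟨
      toℕ i + (toℕ i + toℕ j) / m * m                      ∎)

-- For even m, the residue m/2.
half : (m : ℕ) .{{_ : NonZero m}} → Fin m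
half m = (m / 2) mod m

data BVertex (m : ℕ) : Set where
  u v : Fin m → BVertex m

module _ (m : ℕ) .{{_ : NonZero m}} (R S T : Subset m) where

  record IsBicirculant : Set where
    field
      R≡-R    : ∀ j → j ∈ R ⇔ ⊖ j ∈ R
      T≡-T    : ∀ j → j ∈ T ⇔ ⊖ j ∈ T
      0∉R     : 0ₘ ∉ R
      0∉T     : 0ₘ ∉ T
      0∈S     : 0ₘ ∈ S
      ∣R∣≡∣T∣ : ∣ R ∣ ≡ ∣ T ∣

  data BEdge : Rel (BVertex m) 0ℓ where
    uu : ∀ i {j} → j ∈ R → BEdge (u i) (u (i ⊕ j))
    vv : ∀ i {j} → j ∈ T → BEdge (v i) (v (i ⊕ j))
    uv : ∀ i {j} → j ∈ S → BEdge (u i) (v (i ⊕ j))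

  module _ (isB : IsBicirculant) where
    open IsBicirculant isB

    BEdge-irrefl : ∀ {x y} → BEdge x y → x ≢ y
    BEdge-irrefl (uu i {j} j∈R) eq =
      0∉R (subst (_∈ R) (i≡i⊕j⇒j≡0 i j (u-injective eq)) j∈R)
      where
      u-injective : ∀ {a b} → u a ≡ u b → a ≡ b
      u-injective refl = refl
    BEdge-irrefl (vv i {j} j∈T) eq =
      0∉T (subst (_∈ T) (i≡i⊕j⇒j≡0 i j (v-injective eq)) j∈T)
      where
      v-injective : ∀ {a b} → v a ≡ v b → a ≡ b
      v-injective refl = refl
    BEdge-irrefl (uv i j∈S) ()

    B : Graph
    B = record
      { Vertex = BVertex m
      ; Adj    = SymClosure BEdge
      ; sym    = symmetric BEdge
      ; irrefl = λ where
          eq (fwd e) → BEdge-irrefl e eq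
          eq (bwd e) → BEdge-irrefl e (≡.sym eq)
      }

{-# OPTIONS --safe #-}

-- Let h = m/2, so that w ~ w + h for every vertex w; call this edge a rung. For a subgroup H of ℤ/m
-- containing h, call a block a Hamiltonian cycle of the subgraph on {u_i, v_i : i ∈ H} that contains
-- two rungs of u-vertices and two rungs of v-vertices, in alternating cyclic order.
--
-- Blocks grow: if g is the type of an edge, then a rung of a block Z and a suitable rung of a
-- translate of Z are opposite sides of a 4-cycle whose other sides are edges of type g. Exchanging
-- the sides splices the two cycles, and splicing in this way the translates by one generator of
-- ⟨H, g⟩/H, each into its predecessor, gives a block for ⟨H, g⟩. By connectivity, adding all edge
-- types one after the other reaches H = ℤ/m, so it suffices to find one block.
--
-- Let 0, s, w ∈ S be distinct with s ≠ h. Suppose that an alternating path x_1 … x_N and its translate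
-- by h partition {u_i, v_i : i ∈ H}, and that x_1 ~ x_l with l ≥ 4 even. Writing x′ = x + h, the cycle
--   x_1′ x_1 x_2 x_2′ x_3′ x_3 … x_{l-1}′ x_{l-1} x_l x_{l+1} … x_N x_N′ … x_{l+1}′ x_l′
-- is a block. Let D be least with D s ∈ {0, h}. If D s = 0, take the path v_0 u_0 v_s u_s … with
-- l = N = 2D. If D s = h, concatenate such paths over the cosets of ⟨s⟩ in ⟨s, w⟩, joined by edges of
-- type w. Modulo h, the third neighbour u_{-w} of v_0 lies on the last of them, and exactly one of the
-- two directions in which that last one can be traversed passes through u_{-w} rather than u_{-w+h}.

module Submission where

open import Defs
open import Data.Fin.Subset using (Subset; _∈_; ∣_∣)
open import Data.Nat.Base using (ℕ; NonZero; _≤_)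
open import Data.Nat.Divisibility using (_∣_)

open import Data.Bool.Base using (Bool; true; false; if_then_else_)
open import Data.Fin.Base as Fin using (Fin; toℕ; fromℕ<)
import Data.Fin.Properties as Fin
open import Data.Fin.Properties using (toℕ-injective; toℕ-fromℕ<; toℕ<n)
open import Data.Fin.Subset using (inside; outside; ⁅_⁆; _∪_)
open import Data.Fin.Subset.Properties as Subset using (_∈?_)
open import Data.Integer.Base using (ℤ; +_; -[1+_]; _+_; _-_; _*_; -_; 0ℤ; 1ℤ)
  renaming (∣_∣ to abs)
open import Data.Integer.DivMod using (_%ℕ_; _/ℕ_; n%ℕd<d; a≡a%ℕn+[a/ℕn]*n)
open import Data.Integer.Divisibility.Signed
  using (divides; _∣?_; ∣m∣n⇒∣m+n; ∣m∣n⇒∣m-n; ∣m⇒∣-m; ∣n⇒∣m*n; ∣-refl; ∣-trans; ∣⇒∣ᵤ)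
  renaming (_∣_ to _∣ᶻ_)
import Data.Integer.Properties as ℤ
open import Data.Integer.Tactic.RingSolver using (solve-∀)
open import Data.List.Base
  using (List; []; _∷_; _++_; _∷ʳ_; map; concat; applyUpTo; length; allFin; cartesianProduct)
open import Data.List.Membership.Propositional using () renaming (_∈_ to _∈ˡ_)
open import Data.List.Membership.Propositional.Properties
  using (∈-∃++; ∈-applyUpTo⁺; ∈-concat⁺′; ∈-map⁺; ∈-allFin; ∈-cartesianProduct⁺)
open import Data.List.Properties
  using (map-applyUpTo; map-++; ++-assoc; map-cong; map-id; ++-identityʳ; applyUpTo-∷ʳ; concat-++;
    concat-map)
open import Data.List.Relation.Binary.Permutation.Propositional
  using (_↭_; ↭⇒↭ₛ; ↭-refl; ↭-trans; ↭-sym; ↭-reflexive; prep; swap; module PermutationReasoning)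
import Data.List.Relation.Binary.Permutation.Propositional.Properties as Perm
import Data.List.Relation.Binary.Permutation.Setoid.Properties as PermS
open import Data.List.Relation.Unary.All as All using (All; []; _∷_)
import Data.List.Relation.Unary.All.Properties as All
open import Data.List.Relation.Unary.AllPairs as AllPairs using (AllPairs; []; _∷_)
import Data.List.Relation.Unary.AllPairs.Properties as AllPairs
open import Data.List.Relation.Unary.Any as Any using (Any; here; there)
import Data.List.Relation.Unary.Any.Properties as Any
open import Data.List.Relation.Unary.Linked using (Linked; [-]; _∷_)
open import Data.List.Relation.Unary.Unique.Propositional using (Unique)
open import Data.Nat.Base as ℕ using (zero; suc; _<_; z≤n; s≤s)
open import Data.Nat.DivMod using (_mod_; _/_; m/n*n≡m; m<n⇒m%n≡m)
import Data.Nat.Divisibility as ℕ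
import Data.Nat.Properties as ℕ
open import Data.Product.Base using (∃; ∃-syntax; Σ-syntax; _×_; _,_; proj₁; proj₂)
open import Data.Sum.Base using (_⊎_; inj₁; inj₂; [_,_]′)
open import Data.Vec.Base using (_∷_)
open import Function.Base using (_∘_; _∋_; id)
open import Function.Bundles using (Equivalence)
open import Level using (0ℓ)
open import Relation.Binary.Construct.Closure.ReflexiveTransitive using (Star; ε; _◅_)
open import Relation.Binary.Construct.Closure.Symmetric using (SymClosure; fwd; bwd)
open import Relation.Binary.Core using (Rel)
open import Relation.Binary.Definitions using (Symmetric)
open import Relation.Binary.PropositionalEquality
  using (_≡_; _≢_; refl; sym; trans; cong; cong₂; subst; setoid; resp₂; module ≡-Reasoning)
open import Relation.Nullary using (¬_; Dec; yes; no; contradiction)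
open import Relation.Nullary.Decidable using (does; dec-true; dec-false; map′; _×-dec_; ¬?)
open import Relation.Unary using (Pred; Decidable)

-- Systems of representatives.

-- For `_≈ᵥ_` this describes the vertices of a cycle, each listed once; for `_≡ₕ_` it is a system of
-- representatives modulo `h`.
record Transversal {X : Set} (_~_ : Rel X 0ℓ) (P : Pred X 0ℓ) (xs : List X) : Set where
  field
    sound    : All P xs
    complete : ∀ {x} → P x → Any (x ~_) xs
    distinct : AllPairs (λ x y → ¬ x ~ y) xs

open Transversal

module _ {X : Set} {_~_ : Rel X 0ℓ} where

  Apart : Rel (Pred X 0ℓ) 0ℓ
  Apart P Q = ∀ {x y} → P x → Q y → ¬ x ~ y

  transversal-resp : ∀ {P Q : Pred X 0ℓ} {xs} → (∀ {x} → P x → Q x) → (∀ {x} → Q x → P x) →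
    Transversal _~_ P xs → Transversal _~_ Q xs
  transversal-resp P⊆Q Q⊆P t = record
    { sound = All.map P⊆Q (sound t) ; complete = complete t ∘ Q⊆P ; distinct = distinct t }

  transversal-++ : ∀ {P Q xs ys} → Apart P Q → Transversal _~_ P xs → Transversal _~_ Q ys →
    Transversal _~_ (λ x → P x ⊎ Q x) (xs ++ ys)
  transversal-++ {xs = xs} apart t s = record
    { sound = All.++⁺ (All.map inj₁ (sound t)) (All.map inj₂ (sound s))
    ; complete = [ Any.++⁺ˡ ∘ complete t , Any.++⁺ʳ xs ∘ complete s ]′
    ; distinct = AllPairs.++⁺ (distinct t) (distinct s)
        (All.map (λ p → All.map (apart p) (sound s)) (sound t))
    }

  transversal-concat : ∀ {P : ℕ → Pred X 0ℓ} {f} n →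
    (∀ {j} → j < n → Transversal _~_ (P j) (f j)) →
    (∀ {i j} → i < j → j < n → Apart (P i) (P j)) →
    Transversal _~_ (λ x → ∃ λ j → j < n × P j x) (concat (applyUpTo f n))
  transversal-concat {P} {f} n t apart = record
    { sound = All.concat⁺ (All.applyUpTo⁺₁ f n λ j<n → All.map (λ p → _ , j<n , p) (sound (t j<n)))
    ; complete = λ (j , j<n , p) → Any.concat⁺ (Any.applyUpTo⁺ f (complete (t j<n) p) j<n)
    ; distinct = AllPairs.concat⁺ (All.applyUpTo⁺₁ f n (distinct ∘ t))
        (AllPairs.applyUpTo⁺₁ f n λ i<j j<n →
          All.map (λ p → All.map (apart i<j j<n p) (sound (t j<n))) (sound (t (ℕ.<-trans i<j j<n))))
    }

  transversal-↭ : ∀ {P xs ys} → Symmetric _~_ → xs ↭ ys →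
    Transversal _~_ P xs → Transversal _~_ P ys
  transversal-↭ ~-sym xs↭ys t = record
    { sound = Perm.All-resp-↭ xs↭ys (sound t)
    ; complete = Perm.Any-resp-↭ xs↭ys ∘ complete t
    ; distinct = PermS.AllPairs-resp-↭ (setoid X) (λ x≁y → x≁y ∘ ~-sym) (resp₂ _)
        (↭⇒↭ₛ xs↭ys) (distinct t)
    }

module _ {X Y : Set} {_~_ : Rel X 0ℓ} {_≈_ : Rel Y 0ℓ} where

  transversal-map : ∀ {P Q xs} (f : X → Y) (g : Y → X) →
    (∀ {x} → P x → Q (f x)) → (∀ {y} → Q y → P (g y)) →
    (∀ {y x} → g y ~ x → y ≈ f x) → (∀ {x y} → f x ≈ f y → x ~ y) →
    Transversal _~_ P xs → Transversal _≈_ Q (map f xs)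
  transversal-map f g Pf Pg to from t = record
    { sound = All.map⁺ (All.map Pf (sound t))
    ; complete = Any.map⁺ ∘ Any.map to ∘ complete t ∘ Pg
    ; distinct = AllPairs.map⁺ (AllPairs.map (λ x≁y → x≁y ∘ from) (distinct t))
    }

-- Subgroups of ℤ/m, orders of elements and cosets.

least : ∀ {P : Pred ℕ 0ℓ} → Decidable P → ∀ n → P n → ∃ λ k → P k × (∀ {j} → j < k → ¬ P j)
least P? zero p = zero , p , λ ()
least P? (suc n) p with P? 0
... | yes p₀ = zero , p₀ , λ ()
... | no ¬p₀ with least (P? ∘ suc) n p
... | k , pk , below = suc k , pk , below-suc
  where
  below-suc : ∀ {j} → j < suc k → ¬ _
  below-suc {zero}  _         = ¬p₀
  below-suc {suc j} (s≤s j<k) = below j<k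

-- The subgroups of ℤ/m, seen as the subgroups of ℤ that contain m.
module _ (m : ℕ) .{{_ : NonZero m}} where

  -- With η-equality, comparing two subgroups would compare the proofs in their fields.
  record Subgroup : Set₁ where
    no-eta-equality
    field
      mem     : Pred ℤ 0ℓ
      mem?    : Decidable mem
      +-mem   : ∀ {i j} → mem i → mem j → mem (i + j)
      neg-mem : ∀ {i} → mem i → mem (- i)
      m-mem   : mem (+ m)

    by : ∀ {i j} → mem i → i ≡ j → mem j
    by p eq = subst mem eq p

    sub-mem : ∀ {i j} → mem i → mem j → mem (i - j)
    sub-mem p q = +-mem p (neg-mem q)

    0-mem : mem 0ℤ
    0-mem = by (sub-mem m-mem m-mem) (ℤ.+-inverseʳ (+ m))

    *-mem : ∀ j {i} → mem i → mem (j * i)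
    *-mem (+ n) {i} p = nat n
      where
      nat : ∀ n → mem (+ n * i)
      nat zero = by 0-mem (sym (ℤ.*-zeroˡ i))
      nat (suc n) = by (+-mem p (nat n)) (sym (ℤ.suc-* (+ n) i))
    *-mem -[1+ n ] {i} p = by (neg-mem (*-mem (+ suc n) p)) (ℤ.neg-distribˡ-* (+ suc n) i)

    multiple-mem : ∀ {i} → + m ∣ᶻ i → mem i
    multiple-mem (divides q eq) = by (*-mem q m-mem) (sym eq)

  open Subgroup public

  _≈[_]_ : ℤ → Subgroup → ℤ → Set
  i ≈[ H ] j = mem H (i - j)

  principal : ∀ n → + n ∣ᶻ + m → Subgroup
  principal n n∣m .mem     = + n ∣ᶻ_
  principal n n∣m .mem?    = + n ∣?_
  principal n n∣m .+-mem   = ∣m∣n⇒∣m+n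
  principal n n∣m .neg-mem = ∣m⇒∣-m
  principal n n∣m .m-mem   = n∣m

  -- The order of `z` modulo `H` is `suc k`; keeping its predecessor makes it positive by
  -- construction.
  record Index (H : Subgroup) (z : ℤ) (k : ℕ) : Set where
    field
      returns : mem H (+ suc k * z)
      minimal : ∀ {j} → j < k → ¬ mem H (+ suc j * z)

  open Index public

  abstract
    -- The search for the order succeeds within `m` steps, since `+ m * z` is in `H`.
    index : ∀ H z → ∃ (Index H z)
    index H z with least (λ j → mem? H (+ suc j * z)) (ℕ.pred m)
                     (by H (*-mem H z (m-mem H))
                       (trans (ℤ.*-comm z (+ m)) (cong (λ n → + n * z) (sym (ℕ.suc-pred m)))))
    ... | k , returns , minimal = k , record { returns = returns ; minimal = minimal }

  index-neg : ∀ {H z k} → Index H z k → Index H (- z) k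
  index-neg {H} {z} {k} ind = record
    { returns = by H (neg-mem H (returns ind)) (ℤ.neg-distribʳ-* (+ suc k) z)
    ; minimal = λ {j} j<k p → minimal ind j<k
        (by H (neg-mem H p) (((∀ a b → - (a * - b) ≡ a * b) ∋ solve-∀) (+ suc j) z))
    }

  -- As `+ suc k * z` is in `H`, the multiplier `j` may be replaced by its remainder modulo `suc k`.
  reduce : ∀ H {z k} → Index H z k → ∀ i j → mem H (i - j * z) →
    ∃ λ l → l < suc k × mem H (i - + l * z)
  reduce H {z} {k} ind i j p = j %ℕ suc k , n%ℕd<d j (suc k) ,
    by H (+-mem H p (*-mem H (j /ℕ suc k) (returns ind)))
      (trans (cong (λ n → i - n * z + j /ℕ suc k * (+ suc k * z)) (a≡a%ℕn+[a/ℕn]*n j (suc k)))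
        (((∀ i r q n z → i - (r + q * n) * z + q * (n * z) ≡ i - r * z) ∋ solve-∀)
          i (+ (j %ℕ suc k)) (j /ℕ suc k) (+ suc k) z))

  adjoin : Subgroup → ℤ → Subgroup
  adjoin H z .mem i = ∃ λ j → mem H (i - j * z)
  -- By `reduce`, only the multipliers below the order of `z` need testing.
  adjoin H z .mem? i = let k , ind = index H z in
    map′ (λ (l , _ , p) → + l , p) (λ (j , p) → reduce H ind i j p)
      (ℕ.anyUpTo? (λ l → mem? H (i - + l * z)) (suc k))
  adjoin H z .+-mem {a} {b} (i , p) (j , q) = i + j , by H (+-mem H p q)
    (((∀ a b i j z → a - i * z + (b - j * z) ≡ a + b - (i + j) * z) ∋ solve-∀) a b i j z)
  adjoin H z .neg-mem {a} (i , p) = - i , by H (neg-mem H p)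
    (((∀ a i z → - (a - i * z) ≡ - a - - i * z) ∋ solve-∀) a i z)
  adjoin H z .m-mem = 0ℤ , by H (m-mem H) (((∀ a z → a ≡ a - 0ℤ * z) ∋ solve-∀) (+ m) z)

  ⊆-adjoin : ∀ H z {i} → mem H i → mem (adjoin H z) i
  ⊆-adjoin H z {i} p = 0ℤ , by H p (((∀ a z → a ≡ a - 0ℤ * z) ∋ solve-∀) i z)

  ∈-adjoin : ∀ H z → mem (adjoin H z) z
  ∈-adjoin H z = 1ℤ , by H (0-mem H) (((∀ z → 0ℤ ≡ z - 1ℤ * z) ∋ solve-∀) z)

  -- The difference is `+ suc t * z` with `suc t` at most `k`, which `minimal` excludes.
  multiples-apart : ∀ H {z k} → Index H z k → ∀ {i j} → i < j → j < suc k →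
    ¬ mem H (+ j * z - + i * z)
  multiples-apart H {z} {k} ind {i} i<j j<1+k p with ℕ.m≤n⇒∃[o]m+o≡n i<j
  ... | t , refl = minimal ind
    (ℕ.≤-trans (ℕ.s≤s (ℕ.m≤n+m t i)) (ℕ.s≤s⁻¹ j<1+k))
    (by H p (trans
      (cong (λ n → n * z - + i * z) (trans (cong +_ (sym (ℕ.+-suc i t))) (ℤ.pos-+ i (suc t))))
      (((∀ i t z → (i + t) * z - i * z ≡ t * z) ∋ solve-∀) (+ i) (+ suc t) z)))

  module _ {X : Set} {_~_ : Rel X 0ℓ} (idx : X → ℤ) where

    cosets-apart : ∀ H {z k} → Index H z k → (∀ {x y} → x ~ y → idx x ≈[ H ] idx y) → ∀ c {i j} →
      i < j → j < suc k →
      Apart {_~_ = _~_} (λ x → idx x ≈[ H ] (c + + i * z)) (λ x → idx x ≈[ H ] (c + + j * z))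
    cosets-apart H {z} ind ~⇒≈ c {i} {j} i<j j<k {x} {y} p q x~y = multiples-apart H ind i<j j<k
      (by H (sub-mem H (sub-mem H p q) (~⇒≈ x~y))
        (((∀ x y c i j z → x - (c + i * z) - (y - (c + j * z)) - (x - y) ≡ j * z - i * z) ∋ solve-∀)
          (idx x) (idx y) c (+ i) (+ j) z))

    -- The coset of `c` modulo the larger subgroup is the disjoint union of the cosets of
    -- `c + + j * z` modulo `H`. This serves both the vertices of a spliced cycle and the indices of
    -- a path modulo `h`.
    transversal-adjoin : ∀ H {z k} → Index H z k → (∀ {x y} → x ~ y → idx x ≈[ H ] idx y) →
      ∀ c {f} →
      (∀ {j} → j < suc k → Transversal _~_ (λ x → idx x ≈[ H ] (c + + j * z)) (f j)) →
      Transversal _~_ (λ x → idx x ≈[ adjoin H z ] c) (concat (applyUpTo f (suc k)))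
    transversal-adjoin H {z} {k} ind ~⇒≈ c t = transversal-resp
      (λ {x} (j , _ , p) → + j , by H p (assoc (idx x) c (+ j) z))
      (λ {x} (j , p) → let l , l<k , q = reduce H ind (idx x - c) j p in
        l , l<k , by H q (sym (assoc (idx x) c (+ l) z)))
      (transversal-concat (suc k) t (cosets-apart H ind ~⇒≈ c))
      where
      assoc : ∀ x c j z → x - (c + j * z) ≡ x - c - j * z
      assoc = solve-∀

-- Walks between vertices with integer indices.

data Side : Set where
  U V : Side

-- `Conn s t i` says that a vertex on side `s` is joined to the one on side `t` whose index exceeds
-- its own by `i`. Integer indices, considered modulo `m`, turn index computations into ring
-- identities.
module Core
  (m h : ℕ) .{{_ : NonZero m}} .{{_ : NonZero h}} (m≡h+h : + m ≡ + h + + h)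
  (Conn : Side → Side → ℤ → Set)
  (conn-resp : ∀ s t {i j} → + m ∣ᶻ i - j → Conn s t i → Conn s t j)
  (conn-sym : ∀ s t {i} → Conn s t i → Conn t s (- i))
  (conn-rung : ∀ s → Conn s s (+ h))
  where

  Vertexᶻ : Set
  Vertexᶻ = Side × ℤ

  idx : Vertexᶻ → ℤ
  idx = proj₂

  Adjᶻ : Rel Vertexᶻ 0ℓ
  Adjᶻ (s , i) (t , j) = Conn s t (j - i)

  data _≈ᵥ_ : Rel Vertexᶻ 0ℓ where
    same : ∀ {s i j} → + m ∣ᶻ i - j → (s , i) ≈ᵥ (s , j)

  infixr 5 _∷_
  -- The list holds the inner vertices only, so that `Walk x xs x` is a closed walk through `x ∷ xs`
  -- that counts `x` once.
  data Walk : Vertexᶻ → List Vertexᶻ → Vertexᶻ → Set where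
    [_] : ∀ {x y} → Adjᶻ x y → Walk x [] y
    _∷_ : ∀ {x y z ys} → Adjᶻ x y → Walk y ys z → Walk x (y ∷ ys) z

  _++ʷ_ : ∀ {x y z ys zs} → Walk x ys y → Walk y zs z → Walk x (ys ++ y ∷ zs) z
  [ e ]   ++ʷ w′ = e ∷ w′
  (e ∷ w) ++ʷ w′ = e ∷ (w ++ʷ w′)

  split : ∀ {x z y} ys {zs} → Walk x (ys ++ y ∷ zs) z → Walk x ys y × Walk y zs z
  split []       (e ∷ w) = [ e ] , w
  split (_ ∷ ys) (e ∷ w) = let w₁ , w₂ = split ys w in e ∷ w₁ , w₂

  translate : ℤ → Vertexᶻ → Vertexᶻ
  translate z (s , i) = s , i + z

  adj-translate : ∀ z {x y} → Adjᶻ x y → Adjᶻ (translate z x) (translate z y)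
  adj-translate z {s , i} {t , j} =
    subst (Conn s t) (((∀ i j z → j - i ≡ (j + z) - (i + z)) ∋ solve-∀) i j z)

  walk-translate : ∀ z {x y ys} → Walk x ys y →
    Walk (translate z x) (map (translate z) ys) (translate z y)
  walk-translate z {x} {y} [ e ] = [ adj-translate z {x} {y} e ]
  walk-translate z {x} (_∷_ {y = y} e w) = adj-translate z {x} {y} e ∷ walk-translate z w

  -- Splicing the translates of a cycle.

  -- The closed walk is opened at its first edge, from `c` to `ĉ`, and inserted between `x` and
  -- `x̂`: two opposite sides of the 4-cycle `x x̂ c ĉ` are exchanged for the other two.
  splice : ∀ {a b x x̂ c ĉ ys} us {ws} → Walk a (us ++ x ∷ x̂ ∷ ws) b → Walk c (ĉ ∷ ys) c →
    Adjᶻ x ĉ → Adjᶻ c x̂ → Walk a (us ++ x ∷ (ĉ ∷ ys) ++ c ∷ x̂ ∷ ws) b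
  splice []       (e ∷ _ ∷ w) (_ ∷ w′) f g = e ∷ f ∷ (w′ ++ʷ (g ∷ w))
  splice (_ ∷ us) (e ∷ w)     w′       f g = e ∷ splice us w w′ f g

  splice-↭ : ∀ {x x̂ c : Vertexᶻ} us {ws ys} →
    us ++ x ∷ ys ++ c ∷ x̂ ∷ ws ↭ (us ++ x ∷ x̂ ∷ ws) ++ c ∷ ys
  splice-↭ {x} {x̂} {c} us {ws} {ys} = begin
    us ++ x ∷ ys ++ c ∷ x̂ ∷ ws      ↭⟨ Perm.++⁺ˡ us (prep x (Perm.shift c ys (x̂ ∷ ws))) ⟩
    us ++ x ∷ (c ∷ ys) ++ x̂ ∷ ws    ↭⟨ Perm.++⁺ˡ us (prep x (Perm.++-comm (c ∷ ys) (x̂ ∷ ws))) ⟩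
    us ++ x ∷ x̂ ∷ ws ++ c ∷ ys      ≡⟨ ++-assoc us (x ∷ x̂ ∷ ws) (c ∷ ys) ⟨
    (us ++ x ∷ x̂ ∷ ws) ++ c ∷ ys    ∎
    where open PermutationReasoning

  Closed : List Vertexᶻ → Set
  Closed []       = Walk (U , 0ℤ) [] (U , 0ℤ)
  Closed (x ∷ xs) = Walk x xs x

  Spans : Subgroup m → List Vertexᶻ → Set
  Spans H xs = Closed xs × Transversal _≈ᵥ_ (mem H ∘ idx) xs

  -- `lo` is the end that the cycle meets first. Since `gap` is a congruence and h = -h modulo m,
  -- either end of the edge can be `lo`.
  record Rung (s : Side) : Set where
    field
      lo hi : ℤ
      gap   : + m ∣ᶻ hi - lo - + h

  open Rung

  infixr 5 _▷_
  _▷_ : ∀ {s} → Rung s → List Vertexᶻ → List Vertexᶻ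
  _▷_ {s} r xs = (s , lo r) ∷ (s , hi r) ∷ xs

  translate-rung : ∀ {s} → ℤ → Rung s → Rung s
  translate-rung z r = record
    { lo = lo r + z ; hi = hi r + z
    ; gap = subst (+ m ∣ᶻ_) (((∀ a b h z → b - a - h ≡ (b + z) - (a + z) - h) ∋ solve-∀)
        (lo r) (hi r) (+ h) z) (gap r) }

  ≈ᵥ-sym : Symmetric _≈ᵥ_
  ≈ᵥ-sym (same {i = i} {j} d) =
    same (subst (+ m ∣ᶻ_) (((∀ i j → - (i - j) ≡ j - i) ∋ solve-∀) i j) (∣m⇒∣-m d))

  translate-zero : ∀ z xs → map (translate (0ℤ * z)) xs ≡ xs
  translate-zero z xs = trans
    (map-cong (λ (s , i) → cong (s ,_) (((∀ i z → i + 0ℤ * z ≡ i) ∋ solve-∀) i z)) xs)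
    (map-id xs)

  -- The copy of the cycle translated by (1 + j) z, opened at its rung c, is spliced into the
  -- rung x of the copy translated by j z.
  module _ {H : Subgroup m} {s t} (c : Rung s) (P : List Vertexᶻ) (x : Rung t) (Q : List Vertexᶻ)
    (g : ℤ) (g-conn : Conn t s g) (spans : Spans H (c ▷ P ++ x ▷ Q)) where

    private
      Z : List Vertexᶻ
      Z = c ▷ P ++ x ▷ Q

      z : ℤ
      -- Chosen so that `hi c`, moved on by `z`, is `lo x + g`.
      z = g + lo x - hi c

      copies : ℕ → List Vertexᶻ
      copies n = concat (applyUpTo (λ j → map (translate (+ j * z)) Z) n)

      copies-suc : ∀ n → copies (suc n) ≡ copies n ++ map (translate (+ n * z)) Z
      copies-suc n = begin
        concat (applyUpTo f (suc n))          ≡⟨ cong concat (applyUpTo-∷ʳ f n) ⟨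
        concat (applyUpTo f n ∷ʳ f n)         ≡⟨ concat-++ (applyUpTo f n) (f n ∷ []) ⟨
        concat (applyUpTo f n) ++ f n ++ []   ≡⟨ cong (copies n ++_) (++-identityʳ (f n)) ⟩
        copies n ++ f n                       ∎
        where
        open ≡-Reasoning
        f : ℕ → List Vertexᶻ
        f j = map (translate (+ j * z)) Z

      enter : ∀ j → Adjᶻ (t , lo x + j * z) (s , hi c + (1ℤ + j) * z)
      enter j = subst (Conn t s)
        (((∀ g x ĉ j → g ≡ ĉ + (1ℤ + j) * (g + x - ĉ) - (x + j * (g + x - ĉ))) ∋ solve-∀)
          g (lo x) (hi c) j) g-conn

      -- Each of the two rungs contributes a shift by `h`, so the index difference is `- g` up to 2h
      -- = m: the edge of `enter`, reversed.
      leave : ∀ j → Adjᶻ (s , lo c + (1ℤ + j) * z) (t , hi x + j * z)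
      leave j = conn-resp s t
        (subst (+ m ∣ᶻ_)
          (((∀ h g x x̂ c ĉ j → - (x̂ - x - h) - (ĉ - c - h) - (h + h)
               ≡ - g - ((x̂ + j * (g + x - ĉ)) - (c + (1ℤ + j) * (g + x - ĉ))))
            ∋ solve-∀) (+ h) g (lo x) (hi x) (lo c) (hi c) j)
          (∣m∣n⇒∣m-n (∣m∣n⇒∣m-n (∣m⇒∣-m (gap x)) (gap c))
            (divides 1ℤ (trans (sym m≡h+h) (sym (ℤ.*-identityˡ (+ m)))))))
        (conn-sym t s g-conn)

      -- `P` stays directly after `c` and `Q` at the end of the cycle, so the rungs inside them
      -- survive in their order; new vertices appear only around the latest copy of `x`.
      record Chain (n : ℕ) : Set where
        field
          {P′ Q′} : List Vertexᶻ
          prefix  : ∃ λ A → P′ ≡ P ++ A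
          suffix  : ∃ λ B → Q′ ≡ B ++ Q
          closed  : Closed (c ▷ P′ ++ translate-rung (+ n * z) x ▷ Q′)
          perm    : c ▷ P′ ++ translate-rung (+ n * z) x ▷ Q′ ↭ copies (suc n)

      chain : ∀ n → Chain n
      chain zero = record
        { prefix = [] , sym (++-identityʳ P)
        ; suffix = [] , refl
        ; closed = subst (λ r → Closed (c ▷ P ++ r ++ Q)) (sym (translate-zero z (x ▷ [])))
            (proj₁ spans)
        ; perm   = ↭-reflexive (trans
            (cong (λ r → c ▷ P ++ r ++ Q) (translate-zero z (x ▷ [])))
            (trans (sym (translate-zero z Z)) (sym (++-identityʳ _))))
        }
      chain (suc n) with chain n
      ... | record { P′ = P′ ; Q′ = Q′ ; prefix = A , refl ; suffix = B , refl
                   ; closed = closed ; perm = perm } = record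
        -- From `lo-x` the new copy is entered at `hi-c`; it is run through along its `P`, its rung
        -- `x` and its `Q` up to `lo-c`, which leads back to `hi-x`.
        { prefix = A ++ lo-x ∷ hi-c ∷ map τ P , ++-assoc P A _
        ; suffix = map τ Q ++ lo-c ∷ hi-x ∷ B , sym (++-assoc (map τ Q) _ Q)
        ; closed = subst (λ l → Closed (c ▷ l)) assoc
            (splice ((s , hi c) ∷ P ++ A) closed copy (enter (+ n)) (leave (+ n)))
        ; perm   = begin
            c ▷ ((P ++ A) ++ lo-x ∷ hi-c ∷ map τ P) ++
              translate-rung (+ suc n * z) x ▷ map τ Q ++ lo-c ∷ hi-x ∷ B ++ Q
              ≡⟨ cong (c ▷_) assoc ⟨
            c ▷ (P ++ A) ++ lo-x ∷ (hi-c ∷ copied) ++ lo-c ∷ hi-x ∷ B ++ Q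
              ↭⟨ splice-↭ (c ▷ P ++ A) ⟩
            (c ▷ (P ++ A) ++ translate-rung (+ n * z) x ▷ B ++ Q) ++ lo-c ∷ hi-c ∷ copied
              ↭⟨ Perm.++⁺ʳ _ perm ⟩
            copies (suc n) ++ lo-c ∷ hi-c ∷ copied
              ≡⟨ cong (λ l → copies (suc n) ++ lo-c ∷ hi-c ∷ l) (map-++ τ P (x ▷ Q)) ⟨
            copies (suc n) ++ map τ Z
              ≡⟨ copies-suc (suc n) ⟨
            copies (suc (suc n)) ∎
        }
        where
        open PermutationReasoning
        τ : Vertexᶻ → Vertexᶻ
        τ = translate (+ suc n * z)
        lo-x hi-x lo-c hi-c : Vertexᶻ
        lo-x = t , lo x + + n * z
        hi-x = t , hi x + + n * z
        lo-c = s , lo c + + suc n * z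
        hi-c = s , hi c + + suc n * z
        copied : List Vertexᶻ
        copied = map τ P ++ translate-rung (+ suc n * z) x ▷ map τ Q
        copy : Walk lo-c (hi-c ∷ copied) lo-c
        copy = subst (λ l → Walk lo-c (hi-c ∷ l) lo-c)
          (map-++ τ P (x ▷ Q)) (walk-translate (+ suc n * z) (proj₁ spans))
        assoc : ∀ {ws} → (P ++ A) ++ lo-x ∷ (hi-c ∷ copied) ++ ws ≡
          ((P ++ A) ++ lo-x ∷ hi-c ∷ map τ P) ++ translate-rung (+ suc n * z) x ▷ map τ Q ++ ws
        assoc {ws} = trans
          (cong (λ l → (P ++ A) ++ lo-x ∷ hi-c ∷ l)
            (++-assoc (map τ P) (translate-rung (+ suc n * z) x ▷ map τ Q) ws))
          (sym (++-assoc (P ++ A) (lo-x ∷ hi-c ∷ map τ P) _))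

    Extension : Set₁
    Extension = Σ[ H′ ∈ Subgroup m ] (∀ {i} → mem H i → mem H′ i) × mem H′ g ×
      ∃[ A ] ∃[ x′ ] ∃[ B ] Spans H′ (c ▷ (P ++ A) ++ _▷_ {t} x′ (B ++ Q))

    -- With `suc k` the order of `z` modulo `H`, the `suc k` translates fill `adjoin m H z`. This
    -- contains `g`, because `lo x` and `hi c` are in `H`.
    extend : Extension
    extend with index m H z
    ... | k , ind with chain k
    ... | record { prefix = A , refl ; suffix = B , refl ; closed = closed ; perm = perm } =
      adjoin m H z , ⊆-adjoin m H z , g∈ , A , translate-rung (+ k * z) x , B , closed ,
      transversal-↭ ≈ᵥ-sym (↭-sym perm)
        (transversal-resp
          (λ {a} (j , p) → j , by H p (shift0 (idx a) j))
          (λ {a} (j , p) → j , by H p (sym (shift0 (idx a) j)))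
          (transversal-adjoin m idx H ind (λ { (same d) → multiple-mem H d }) 0ℤ
            (λ {j} _ → translated (+ j * z))))
      where
      open Subgroup
      shift0 : ∀ i j → i - 0ℤ - j * z ≡ i - j * z
      shift0 i j = ((∀ i j z → i - 0ℤ - j * z ≡ i - j * z) ∋ solve-∀) i j z
      translated : ∀ y → Transversal _≈ᵥ_ (λ a → mem H (idx a - (0ℤ + y))) (map (translate y) Z)
      translated y = transversal-map (translate y) (translate (- y))
        (λ {a} p → by H p (((∀ i y → i ≡ i + y - (0ℤ + y)) ∋ solve-∀) (idx a) y))
        (λ {a} p → by H p (((∀ i y → i - (0ℤ + y) ≡ i + - y) ∋ solve-∀) (idx a) y))
        (λ { {_ , i} {_ , j} (same d) →
          same (subst (+ m ∣ᶻ_) (((∀ i j y → i + - y - j ≡ i - (j + y)) ∋ solve-∀) i j y) d) })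
        (λ { {_ , i} {_ , j} (same d) →
          same (subst (+ m ∣ᶻ_) (((∀ i j y → i + y - (j + y) ≡ i - j) ∋ solve-∀) i j y) d) })
        (proj₂ spans)
      g∈ : mem (adjoin m H z) g
      g∈ = recover (adjoin m H z) {g} {lo x} {hi c} (∈-adjoin m H z)
        (⊆-adjoin m H z (All.head (All.++⁻ʳ P (All.tail (All.tail within)))))
        (⊆-adjoin m H z (All.head (All.tail within)))
        where
        within : All (mem H ∘ idx) Z
        within = sound (proj₂ spans)
        recover : ∀ (K : Subgroup m) {g x ĉ} → mem K (g + x - ĉ) → mem K x → mem K ĉ → mem K g
        recover K {g} {x} {ĉ} p q r = by K (+-mem K (sub-mem K p q) r)
          (((∀ g x ĉ → (g + x - ĉ) - x + ĉ ≡ g) ∋ solve-∀) g x ĉ)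

  -- Blocks and their growth.

  -- The sides are parameters so that `turn` can exchange them, which halves the cases of `grow`.
  record Block (H : Subgroup m) (s t : Side) : Set where
    constructor cyclic
    field
      r₁    : Rung s
      A₁    : List Vertexᶻ
      r₂    : Rung t
      A₂    : List Vertexᶻ
      r₃    : Rung s
      A₃    : List Vertexᶻ
      r₄    : Rung t
      A₄    : List Vertexᶻ
      spans : Spans H (r₁ ▷ A₁ ++ r₂ ▷ A₂ ++ r₃ ▷ A₃ ++ r₄ ▷ A₄)

  rotate : ∀ {H s t} {r : Rung s} {r′ : Rung t} A {B} →
    Spans H (r ▷ A ++ r′ ▷ B) → Spans H (r′ ▷ B ++ r ▷ A)
  rotate {r = r} {r′} A {B} (w , t) with split ((_ , hi r) ∷ A) w
  ... | w₁ , w₂ = w₂ ++ʷ w₁ , transversal-↭ ≈ᵥ-sym (Perm.++-comm (r ▷ A) (r′ ▷ B)) t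

  turn : ∀ {H s t} → Block H s t → Block H t s
  turn {H} (cyclic r₁ A r₂ B r₃ C r₄ D spans) = cyclic r₂ B r₃ C r₄ D r₁ A
    (subst (Spans H ∘ (r₂ ▷_))
        (trans (++-assoc B _ _) (cong (λ l → B ++ r₃ ▷ l) (++-assoc C _ _)))
        (rotate {H} {r = r₁} {r₂} A spans))

  Grown : Subgroup m → ℤ → Side → Side → Set₁
  Grown H g s t = Σ[ H′ ∈ Subgroup m ] (∀ {i} → mem H i → mem H′ i) × mem H′ g × Block H′ s t

  turn-grown : ∀ H {g s t} → Grown H g s t → Grown H g t s
  turn-grown _ (H′ , H⊆H′ , g∈ , b) = H′ , H⊆H′ , g∈ , turn b

  -- Copies opened at `r₁` are spliced in at `r₃`. Then `r₂` lies in the preserved prefix and `r₄`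
  -- in the preserved suffix, so the rungs still alternate: this is what the alternating order is
  -- for.
  grow-same : ∀ {H s t g} → Conn s s g → Block H s t → Grown H g s t
  grow-same {H} {g = g} conn (cyclic r₁ A r₂ B r₃ C r₄ D spans)
    with extend {H} r₁ (A ++ r₂ ▷ B) r₃ (C ++ r₄ ▷ D) g conn
      (subst (Spans H ∘ (r₁ ▷_)) (sym (++-assoc A _ _)) spans)
  ... | H′ , H⊆H′ , g∈ , E , x , F , spans′ = H′ , H⊆H′ , g∈ , cyclic r₁ A r₂ (B ++ E) x (F ++ C) r₄ D
    (subst (Spans H′ ∘ (r₁ ▷_))
        (trans (cong₂ (λ k l → k ++ x ▷ l) (++-assoc A _ E) (sym (++-assoc F C _)))
          (++-assoc A _ _))
        spans′)

  -- Copies opened at `r₁` are spliced in at its successor `r₂`, whose place is taken by a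
  -- translate; `r₃` and `r₄` are in the preserved suffix.
  grow-cross : ∀ {H s t g} → Conn t s g → Block H s t → Grown H g s t
  grow-cross {H} {g = g} conn (cyclic r₁ A r₂ B r₃ C r₄ D spans)
    with extend {H} r₁ A r₂ (B ++ r₃ ▷ C ++ r₄ ▷ D) g conn spans
  ... | H′ , H⊆H′ , g∈ , E , x , F , spans′ = H′ , H⊆H′ , g∈ , cyclic r₁ (A ++ E) x (F ++ B) r₃ C r₄ D
    (subst (λ l → Spans H′ (r₁ ▷ (A ++ E) ++ x ▷ l)) (sym (++-assoc F B _)) spans′)

  grow : ∀ s t {H g} → Conn s t g → Block H U V → Grown H g U V
  grow U U conn b = grow-same conn b
  grow U V {H} conn b = turn-grown H (grow-cross conn (turn b))
  grow V U conn b = grow-cross conn b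
  grow V V {H} conn b = turn-grown H (grow-same conn (turn b))

  -- Alternating paths and the cycles built on them.

  -- An alternating path is encoded by the list of pairs (a , b) of indices of its consecutive
  -- vertices v_a, u_b; Zag b ps b′ leaves from an extra vertex u_b and ends in u_b′.
  data Zag : ℤ → List (ℤ × ℤ) → ℤ → Set where
    []  : ∀ {b} → Zag b [] b
    zag : ∀ {b a b′ b″ ps} → Adjᶻ (U , b) (V , a) → Adjᶻ (V , a) (U , b′) → Zag b′ ps b″ →
      Zag b ((a , b′) ∷ ps) b″

  _++ᶻ_ : ∀ {b b′ b″ ps qs} → Zag b ps b′ → Zag b′ qs b″ → Zag b (ps ++ qs) b″
  []        ++ᶻ y = y
  zag e f x ++ᶻ y = zag e f (x ++ᶻ y)

  adj-sym : ∀ {s i t j} → Adjᶻ (s , i) (t , j) → Adjᶻ (t , j) (s , i)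
  adj-sym {s} {i} {t} {j} e =
    subst (Conn t s) (((∀ i j → - (j - i) ≡ i - j) ∋ solve-∀) i j) (conn-sym s t e)

  shift-adj : ∀ {s i t j} → Adjᶻ (s , i) (t , j) → Adjᶻ (s , i + + h) (t , j + + h)
  shift-adj {s} {i} {t} {j} = adj-translate (+ h) {s , i} {t , j}

  rung-up : ∀ {s i} → Adjᶻ (s , i) (s , i + + h)
  rung-up {s} {i} = subst (Conn s s) (((∀ i h → h ≡ i + h - i) ∋ solve-∀) i (+ h)) (conn-rung s)

  rung-down : ∀ {s i} → Adjᶻ (s , i + + h) (s , i)
  rung-down {s} {i} = adj-sym {s} {i} {s} {i + + h} (rung-up {s} {i})

  up : ∀ {s} → ℤ → Rung s
  up i = record { lo = i ; hi = i + + h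
    ; gap = divides 0ℤ (((∀ i h → i + h - i - h ≡ 0ℤ) ∋ solve-∀) i (+ h)) }

  down : ∀ {s} → ℤ → Rung s
  down i = record { lo = i + + h ; hi = i
    ; gap = divides (- 1ℤ) (trans (((∀ i h → i - (i + h) - h ≡ - (h + h)) ∋ solve-∀) i (+ h))
        (trans (cong -_ (sym m≡h+h)) (((∀ m → - m ≡ - 1ℤ * m) ∋ solve-∀) (+ m)))) }

  -- Along the path to its end, across the rung there, and back along the translate by `h`.
  there-and-back : ℤ → List (ℤ × ℤ) → List Vertexᶻ
  there-and-back b []              = up {U} b ▷ []
  there-and-back b ((a , b′) ∷ ps) =
    (U , b) ∷ (V , a) ∷ there-and-back b′ ps ++ (V , a + + h) ∷ (U , b + + h) ∷ []

  -- What follows x_1′ x_1 x_2 x_2′ in the cycle of the overview, with `(a , b)` the pair of x_{l-1}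
  -- and x_l: a zigzag across the rungs up to that pair, then `there-and-back`.
  lollipop : List (ℤ × ℤ) → ℤ → ℤ → List (ℤ × ℤ) → List Vertexᶻ
  lollipop []               a b qs = down {V} a ▷ there-and-back b qs
  lollipop ((a₀ , b₀) ∷ ps) a b qs = down {V} a₀ ▷ up {U} b₀ ▷ lollipop ps a b qs

  there-and-back-walk : ∀ {b qs b′ x y} → Zag b qs b′ → Adjᶻ x (U , b) → Adjᶻ (U , b + + h) y →
    Walk x (there-and-back b qs) y
  there-and-back-walk {b} [] f g = f ∷ rung-up {i = b} ∷ [ g ]
  there-and-back-walk {b} (zag {a = a} {b′} e₁ e₂ z) f g = f ∷ e₁ ∷
    (there-and-back-walk z e₂ (adj-sym {V} {a + + h} {U} {b′ + + h} (shift-adj {V} {a} {U} {b′} e₂))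
      ++ʷ (adj-sym {U} {b + + h} {V} {a + + h} (shift-adj {U} {b} {V} {a} e₁) ∷ [ g ]))

  lollipop-walk : ∀ {b₀ b′ a b qs y} ps → Zag b₀ (ps ++ (a , b) ∷ qs) b′ → Adjᶻ (U , b + + h) y →
    Walk (U , b₀ + + h) (lollipop ps a b qs) y
  lollipop-walk {b₀} [] (zag {a = a} e₁ e₂ z) g =
    shift-adj {U} {b₀} {V} {a} e₁ ∷ rung-down {i = a} ∷ there-and-back-walk z e₂ g
  lollipop-walk {b₀} (_ ∷ ps) (zag {a = a} {b′} e₁ e₂ z) g =
    shift-adj {U} {b₀} {V} {a} e₁ ∷ rung-down {i = a} ∷ e₂ ∷ rung-up {i = b′} ∷ lollipop-walk ps z g

  fibres : Side → List ℤ → List Vertexᶻ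
  fibres s []       = []
  fibres s (i ∷ is) = up {s} i ▷ fibres s is

  pair-fibres : List (ℤ × ℤ) → List Vertexᶻ
  pair-fibres []             = []
  pair-fibres ((a , b) ∷ ps) = up {V} a ▷ up {U} b ▷ pair-fibres ps

  pair-fibres-↭ : ∀ ps → pair-fibres ps ↭ fibres V (map proj₁ ps) ++ fibres U (map proj₂ ps)
  pair-fibres-↭ []             = ↭-refl
  pair-fibres-↭ ((a , b) ∷ ps) = prep _ (prep _ (↭-trans
    (prep _ (prep _ (pair-fibres-↭ ps)))
    (Perm.shifts (up {U} b ▷ []) (fibres V (map proj₁ ps)))))

  there-and-back-↭ : ∀ b qs → there-and-back b qs ↭ up {U} b ▷ pair-fibres qs
  there-and-back-↭ b []              = ↭-refl
  there-and-back-↭ b ((a , b′) ∷ qs) = prep _ (begin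
    (V , a) ∷ there-and-back b′ qs ++ (V , a + + h) ∷ (U , b + + h) ∷ []
      ↭⟨ prep _ (Perm.++-comm (there-and-back b′ qs) _) ⟩
    up {V} a ▷ (U , b + + h) ∷ there-and-back b′ qs
      ↭⟨ Perm.shift (U , b + + h) (up {V} a ▷ []) _ ⟩
    (U , b + + h) ∷ up {V} a ▷ there-and-back b′ qs
      ↭⟨ prep _ (prep _ (prep _ (there-and-back-↭ b′ qs))) ⟩
    (U , b + + h) ∷ up {V} a ▷ up {U} b′ ▷ pair-fibres qs ∎)
    where open PermutationReasoning

  lollipop-↭ : ∀ ps a b qs → lollipop ps a b qs ↭ pair-fibres (ps ++ (a , b) ∷ qs)
  lollipop-↭ []               a b qs = swap _ _ (there-and-back-↭ b qs)
  lollipop-↭ ((a₀ , b₀) ∷ ps) a b qs = swap _ _ (prep _ (prep _ (lollipop-↭ ps a b qs)))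

  there-and-back-rung : ∀ b qs →
    ∃[ C ] ∃[ r ] ∃[ D ] there-and-back b qs ≡ C ++ _▷_ {U} r D
  there-and-back-rung b []              = [] , up b , [] , refl
  there-and-back-rung b ((a , b′) ∷ qs) with there-and-back-rung b′ qs
  ... | C , r , D , eq = (U , b) ∷ (V , a) ∷ C , r , _ ,
    cong (λ l → (U , b) ∷ (V , a) ∷ l) (trans (cong (_++ _) eq) (++-assoc C (r ▷ D) _))

  -- The list opens with a `V`-rung, and `there-and-back` crosses a `U`-rung where it turns; these
  -- become the last two rungs of the block.
  lollipop-rungs : ∀ ps a b qs →
    ∃[ r ] ∃[ C ] ∃[ r′ ] ∃[ D ] lollipop ps a b qs ≡ _▷_ {V} r (C ++ _▷_ {U} r′ D)
  lollipop-rungs [] a b qs with there-and-back-rung b qs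
  ... | C , r′ , D , eq = down a , C , r′ , D , cong (down {V} a ▷_) eq
  lollipop-rungs ((a₀ , b₀) ∷ ps) a b qs with lollipop-rungs ps a b qs
  ... | r , C , r′ , D , eq = down a₀ , up b₀ ▷ r ▷ C , r′ , D ,
    cong (λ l → down {V} a₀ ▷ up {U} b₀ ▷ l) eq

  -- Indices modulo h, and the block of an alternating path.

  h∣m : + h ∣ᶻ + m
  h∣m = divides (+ 2) (trans m≡h+h (((∀ h → h + h ≡ + 2 * h) ∋ solve-∀) (+ h)))

  m∤h : ¬ + m ∣ᶻ + h
  m∤h d = ℕ.<⇒≱ (ℕ.m<m+n h (ℕ.>-nonZero⁻¹ h))
    (subst (_≤ h) (ℤ.+-injective m≡h+h) (ℕ.∣⇒≤ (∣⇒∣ᵤ d)))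

  -- As m = 2h, the parity of the quotient by `h` decides.
  ∣h⇒∣m⊎∣m : ∀ {i} → + h ∣ᶻ i → + m ∣ᶻ i ⊎ + m ∣ᶻ i - + h
  ∣h⇒∣m⊎∣m {i} (divides q eq) with q %ℕ 2 | q /ℕ 2 | n%ℕd<d q 2 | a≡a%ℕn+[a/ℕn]*n q 2
  ... | 0 | r | _ | refl = inj₁ (divides r (trans eq
    (trans (((∀ r h → (0ℤ + r * + 2) * h ≡ r * (h + h)) ∋ solve-∀) r (+ h))
      (cong (r *_) (sym m≡h+h)))))
  ... | 1 | r | _ | refl = inj₂ (divides r (trans (cong (_- + h) eq)
    (trans (((∀ r h → (1ℤ + r * + 2) * h - h ≡ r * (h + h)) ∋ solve-∀) r (+ h))
      (cong (r *_) (sym m≡h+h)))))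
  ... | suc (suc _) | _ | ℕ.s≤s (ℕ.s≤s ()) | _

  -- In ℤ/m this is the subgroup of 0 and `h`.
  Mod-h : Subgroup m
  Mod-h = principal m h h∣m

  _≡ₕ_ : Rel ℤ 0ℓ
  i ≡ₕ j = + h ∣ᶻ i - j

  all-fibres : ∀ {P : Pred ℤ 0ℓ} {Q : Pred Vertexᶻ 0ℓ} s →
    (∀ {i} → P i → Q (s , i) × Q (s , i + + h)) → ∀ {is} → All P is → All Q (fibres s is)
  all-fibres s f []       = []
  all-fibres s f (p ∷ ps) = let q , q′ = f p in q ∷ q′ ∷ all-fibres s f ps

  any-fibres : ∀ {Q : Pred Vertexᶻ 0ℓ} s {is} → Any (λ i → Q (s , i) ⊎ Q (s , i + + h)) is →
    Any Q (fibres s is)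
  any-fibres s (here (inj₁ q)) = here q
  any-fibres s (here (inj₂ q)) = there (here q)
  any-fibres s (there q)       = there (there (any-fibres s q))

  fibres-distinct : ∀ s {is} → AllPairs (λ i j → ¬ i ≡ₕ j) is →
    AllPairs (λ a b → ¬ a ≈ᵥ b) (fibres s is)
  fibres-distinct s []                 = []
  fibres-distinct s (_∷_ {i} i≢is is!) =
    ((λ { (same d) → m∤h
        (subst (+ m ∣ᶻ_) (((∀ i h → - (i - (i + h)) ≡ h) ∋ solve-∀) i (+ h)) (∣m⇒∣-m d)) })
      ∷ all-fibres s (λ {j} i≢j →
          (λ { (same d) → i≢j (∣-trans h∣m d) })
        , (λ { (same d) → i≢j
            (subst (+ h ∣ᶻ_) (((∀ i j h → i - (j + h) + h ≡ i - j) ∋ solve-∀) i j (+ h))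
              (∣m∣n⇒∣m+n (∣-trans h∣m d) ∣-refl)) })) i≢is)
    ∷ all-fibres s (λ {j} i≢j →
          (λ { (same d) → i≢j
            (subst (+ h ∣ᶻ_) (((∀ i j h → i + h - j - h ≡ i - j) ∋ solve-∀) i j (+ h))
              (∣m∣n⇒∣m-n (∣-trans h∣m d) ∣-refl)) })
        , (λ { (same d) → i≢j
            (subst (+ h ∣ᶻ_) (((∀ i j h → i + h - (j + h) ≡ i - j) ∋ solve-∀) i j (+ h))
              (∣-trans h∣m d)) })) i≢is
    ∷ fibres-distinct s is!

  -- A class modulo `h` splits into the classes of `i` and `i + + h` modulo `m`, the two ends of a
  -- rung.
  transversal-fibres : ∀ (H : Subgroup m) s {is} → mem H (+ h) → Transversal _≡ₕ_ (mem H) is →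
    Transversal _≈ᵥ_ (λ a → proj₁ a ≡ s × mem H (idx a)) (fibres s is)
  transversal-fibres H s h∈ t = record
    { sound    = all-fibres s (λ p → (refl , p) , (refl , +-mem H p h∈)) (sound t)
    ; complete = λ { {_ , i} (refl , p) → any-fibres s (Any.map
        (λ {j} d → [ inj₁ ∘ same
                   , (λ d′ → inj₂ (same (subst (+ m ∣ᶻ_)
                       (((∀ i j h → i - j - h ≡ i - (j + h)) ∋ solve-∀) i j (+ h)) d′))) ]′ (∣h⇒∣m⊎∣m d))
        (complete t p)) }
    ; distinct = fibres-distinct s (distinct t)
    }
    where open Subgroup

  -- The cycle of the overview, where x_1 has index `a₁` and x_l has index `b`. Taking `(a , b)`
  -- from `ps`, after the first pair, gives l ≥ 4; the translate of `chord` by `h` closes the cycle.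
  lollipop-block : ∀ (H : Subgroup m) → mem H (+ h) → ∀ {a₁ b₁ ps e a b} →
    Adjᶻ (V , a₁) (U , b₁) → Zag b₁ ps e → (a , b) ∈ˡ ps → Adjᶻ (U , b) (V , a₁) →
    Transversal _≡ₕ_ (mem H) (map proj₁ ((a₁ , b₁) ∷ ps)) →
    Transversal _≡ₕ_ (mem H) (map proj₂ ((a₁ , b₁) ∷ ps)) →
    Block H U V
  lollipop-block H h∈ {a₁} {b₁} {a = a} {b} first path ab∈ps chord ta tb with ∈-∃++ ab∈ps
  ... | ps , qs , refl with lollipop-walk {a = a} {b} {qs} ps path (shift-adj {U} {b} {V} {a₁} chord)
                          | lollipop-↭ ps a b qs | lollipop-rungs ps a b qs
  ... | walk | perm | r , C , r′ , D , eq rewrite eq = turn (cyclic (down a₁) [] (up b₁) [] r C r′ D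
    ( rung-down {V} {a₁} ∷ first ∷ rung-up {U} {b₁} ∷ walk
    , transversal-↭ ≈ᵥ-sym
        (↭-trans (↭-sym (pair-fibres-↭ ((a₁ , b₁) ∷ ps ++ (a , b) ∷ qs)))
          (swap _ _ (prep _ (prep _ (↭-sym perm)))))
        (transversal-resp
          [ proj₂ , proj₂ ]′
          (λ { {U , _} p → inj₂ (refl , p) ; {V , _} p → inj₁ (refl , p) })
          (transversal-++ (λ { (refl , _) (() , _) (same _) })
            (transversal-fibres H V h∈ ta) (transversal-fibres H U h∈ tb)))))

  -- The first block.

  progression : ℤ → ℤ → ℕ → ℤ
  progression x z j = x + + j * z

  concat-singletons : ∀ (f : ℕ → ℤ) n → concat (applyUpTo (λ j → f j ∷ []) n) ≡ applyUpTo f n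
  concat-singletons f zero    = refl
  concat-singletons f (suc n) = cong (f 0 ∷_) (concat-singletons (f ∘ suc) n)

  transversal-progression : ∀ {z k} → Index m Mod-h z k → ∀ x →
    Transversal _≡ₕ_ (λ i → mem (adjoin m Mod-h z) (i - x)) (applyUpTo (progression x z) (suc k))
  transversal-progression {z} {k} ind x = subst (Transversal _≡ₕ_ _)
    (concat-singletons (progression x z) (suc k))
    (transversal-adjoin m id Mod-h ind id x λ {j} _ → record
      { sound    = subst (+ h ∣ᶻ_) (sym (ℤ.+-inverseʳ (progression x z j))) (divides 0ℤ refl) ∷ []
      ; complete = here
      ; distinct = [] ∷ []
      })

  zag-applyUpTo : ∀ (a b : ℕ → ℤ) → (∀ j → Adjᶻ (V , a j) (U , b j)) →
    (∀ j → Adjᶻ (U , b j) (V , a (suc j))) →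
    ∀ n → Zag (b 0) (applyUpTo (λ j → a (suc j) , b (suc j)) n) (b n)
  zag-applyUpTo a b va ub zero    = []
  zag-applyUpTo a b va ub (suc n) =
    zag (ub 0) (va 1) (zag-applyUpTo (a ∘ suc) (b ∘ suc) (va ∘ suc) (ub ∘ suc) n)

  full-turn : ∀ {D s} → + m ∣ᶻ D * s - + h → + m ∣ᶻ + 2 * D * s
  full-turn {D} {s} m∣ = subst (+ m ∣ᶻ_)
    (trans (cong (λ x → + 2 * (D * s - + h) + x) m≡h+h)
      (((∀ D s h → + 2 * (D * s - h) + (h + h) ≡ + 2 * D * s) ∋ solve-∀) D s (+ h)))
    (∣m∣n⇒∣m+n (∣n⇒∣m*n (+ 2) m∣) ∣-refl)

  -- As D s = h modulo m, s has order 2 D modulo m.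
  half-turn : ∀ {D s} .{{_ : NonZero D}} → + m ∣ᶻ + D * s - + h → ∀ n →
    (∃ λ l → l < D × + m ∣ᶻ n * s - + l * s) ⊎ (∃ λ l → l < D × + m ∣ᶻ n * s + s + + l * s)
  half-turn {D@(suc _)} {s} m∣ n
    with n %ℕ (2 ℕ.* D) | n /ℕ (2 ℕ.* D) | n%ℕd<d n (2 ℕ.* D) | a≡a%ℕn+[a/ℕn]*n n (2 ℕ.* D)
  ... | r | q | r<2D | refl with r ℕ.<? D
  ... | yes r<D = inj₁ (r , r<D , subst (+ m ∣ᶻ_)
    (trans
      (((∀ r q D s → q * (+ 2 * D * s) ≡ (r + q * (+ 2 * D)) * s - r * s) ∋ solve-∀) (+ r) q (+ D) s)
      (cong (λ x → (+ r + q * x) * s - + r * s) (sym (ℤ.pos-* 2 D))))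
    (∣n⇒∣m*n q (full-turn {+ D} {s} m∣)))
  ... | no r≮D with ℕ.m≤n⇒∃[o]m+o≡n r<2D
  -- Here o = 2D - 1 - r, so that r s + s + o s = 2D s vanishes modulo m, and r ≥ D gives o < D.
  ... | o , 1+r+o≡2D = inj₂ (o , o<D , subst (+ m ∣ᶻ_)
    (trans
      (((∀ r q D s → (q + 1ℤ) * (+ 2 * D * s) ≡
          (r + q * (+ 2 * D)) * s - r * s + (+ 2 * D) * s) ∋ solve-∀) (+ r) q (+ D) s)
      (trans
        (cong₂ (λ x y → (+ r + q * x) * s - + r * s + y * s) (sym (ℤ.pos-* 2 D))
          (trans (sym (ℤ.pos-* 2 D)) (trans (cong +_ (sym 1+r+o≡2D)) (ℤ.pos-+ (suc r) o))))
        (((∀ r x s o → x * s - r * s + (1ℤ + r + o) * s ≡ x * s + s + o * s) ∋ solve-∀)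
          (+ r) (+ r + q * + (2 ℕ.* D)) s (+ o))))
    (∣n⇒∣m*n (q + 1ℤ) (full-turn {+ D} {s} m∣)))
    where
    o<D : o < D
    o<D = subst (suc o ≤_) (ℕ.+-identityʳ D)
      (ℕ.+-cancelˡ-≤ D _ _ (ℕ.≤-trans (ℕ.+-monoˡ-≤ (suc o) (ℕ.≮⇒≥ r≮D))
        (ℕ.≤-reflexive (trans (ℕ.+-suc r o) 1+r+o≡2D))))

  -- -w lies in the coset of ⟨s⟩ that contains k (d s + w), as (1 + k) (d s + w) ∈ ⟨s⟩ and
  -- h = (1 + d) s.
  chord-position : ∀ {d s w k c f} → + m ∣ᶻ (1ℤ + d) * s - + h →
    (1ℤ + k) * (d * s + w) - c * s ≡ f * + h →
    + m ∣ᶻ k * (d * s + w) + (d - c - f * (1ℤ + d)) * s + w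
  chord-position {d} {s} {w} {k} {c} {f} m∣ eq = subst (+ m ∣ᶻ_)
    (trans
      (((∀ f s h d c w → - f * ((1ℤ + d) * s - h) ≡
          f * h - (d * s + w) + c * s + (d - c - f * (1ℤ + d)) * s + w) ∋ solve-∀) f s (+ h) d c w)
      (trans
        (cong (λ x → x - (d * s + w) + c * s + (d - c - f * (1ℤ + d)) * s + w) (sym eq))
        (((∀ k e c s n w → (1ℤ + k) * e - c * s - e + c * s + n * s + w ≡ k * e + n * s + w)
            ∋ solve-∀) k (d * s + w) c s (d - c - f * (1ℤ + d)) w)))
    (∣n⇒∣m*n (- f) m∣)

  module _ {s w : ℤ} (conn-0 : Conn U V 0ℤ) (conn-s : Conn U V s) (conn-w : Conn U V w)
    (h∤s : ¬ + h ∣ᶻ s) (m∤w : ¬ + m ∣ᶻ w) (m∤w-s : ¬ + m ∣ᶻ w - s)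
    {d : ℕ} (s-index : Index m Mod-h s d) where

    private
      H₁ : Subgroup m
      H₁ = adjoin m Mod-h s

      -- For `true` the path is v_y u_y v_{y+s} u_{y+s} and so on, for `false` it is v_y u_{y-s}
      -- v_{y-s} u_{y-2s} and so on.
      v-index u-index : Bool → ℤ → ℕ → ℤ
      v-index true  y = progression y s
      v-index false y = progression y (- s)
      u-index true  y = progression y s
      u-index false y = progression (y - s) (- s)

      -- The cycle through v_y formed by the S-edges of types 0 and s, opened at either side of v_y.
      block : Bool → ℤ → List (ℤ × ℤ)
      block dir y = applyUpTo (λ j → v-index dir y j , u-index dir y j) (suc d)

      adj-vu : ∀ {q i j} → Conn U V q → q ≡ i - j → Adjᶻ (V , i) (U , j)
      adj-vu {_} {i} {j} conn eq = adj-sym {U} {j} {V} {i} (subst (Conn U V) eq conn)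

      block-vu : ∀ dir y j → Adjᶻ (V , v-index dir y j) (U , u-index dir y j)
      block-vu true  y j = adj-vu {i = v-index true y j} {u-index true y j} conn-0
        (((∀ y s j → 0ℤ ≡ y + j * s - (y + j * s)) ∋ solve-∀) y s (+ j))
      block-vu false y j = adj-vu {i = v-index false y j} {u-index false y j} conn-s
        (((∀ y s j → s ≡ y + j * - s - (y - s + j * - s)) ∋ solve-∀) y s (+ j))

      block-uv : ∀ dir y j → Adjᶻ (U , u-index dir y j) (V , v-index dir y (suc j))
      block-uv true  y j = subst (Conn U V)
        (((∀ y s j → s ≡ y + (1ℤ + j) * s - (y + j * s)) ∋ solve-∀) y s (+ j)) conn-s
      block-uv false y j = subst (Conn U V)
        (((∀ y s j → 0ℤ ≡ y + (1ℤ + j) * - s - (y - s + j * - s)) ∋ solve-∀) y s (+ j)) conn-0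

      backwards : ∀ {x y i} → mem H₁ (x - y) →
        (mem (adjoin m Mod-h (- s)) (i - x) → mem H₁ (i - y)) ×
        (mem H₁ (i - y) → mem (adjoin m Mod-h (- s)) (i - x))
      backwards {x} {y} {i} (k , p) =
        (λ (j , q) → k - j , Subgroup.by Mod-h (Subgroup.+-mem Mod-h p q)
          (((∀ x y i k j s → (x - y - k * s) + (i - x - j * - s) ≡ i - y - (k - j) * s) ∋ solve-∀)
            x y i k j s))
        , (λ (j , q) → k - j , Subgroup.by Mod-h (Subgroup.sub-mem Mod-h q p)
          (((∀ x y i k j s → (i - y - j * s) - (x - y - k * s) ≡ i - x - (k - j) * - s) ∋ solve-∀)
            x y i k j s))

      transversal-backwards : ∀ {x y} → mem H₁ (x - y) →
        Transversal _≡ₕ_ (λ i → mem H₁ (i - y)) (applyUpTo (progression x (- s)) (suc d))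
      transversal-backwards {x} {y} p = transversal-resp
        (λ {i} → proj₁ (backwards {x} {y} {i} p)) (λ {i} → proj₂ (backwards {x} {y} {i} p))
        (transversal-progression (index-neg m s-index) x)

      transversal-v : ∀ dir y →
        Transversal _≡ₕ_ (λ i → mem H₁ (i - y)) (applyUpTo (v-index dir y) (suc d))
      transversal-v true  y = transversal-progression s-index y
      transversal-v false y = transversal-backwards {y} {y}
        (Subgroup.by H₁ (Subgroup.0-mem H₁) (sym (ℤ.+-inverseʳ y)))

      transversal-u : ∀ dir y →
        Transversal _≡ₕ_ (λ i → mem H₁ (i - y)) (applyUpTo (u-index dir y) (suc d))
      transversal-u true  y = transversal-progression s-index y
      transversal-u false y = transversal-backwards {y - s} {y}
        (Subgroup.by H₁ (Subgroup.neg-mem H₁ {s} (∈-adjoin m Mod-h s))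
          (((∀ y s → - s ≡ y - s - y) ∋ solve-∀) y s))

      block-v : ∀ dir y →
        Transversal _≡ₕ_ (λ i → mem H₁ (i - y)) (map proj₁ (block dir y))
      block-v dir y = subst (Transversal _≡ₕ_ _)
        (sym (map-applyUpTo (λ j → v-index dir y j , u-index dir y j) proj₁ (suc d)))
        (transversal-v dir y)

      block-u : ∀ dir y →
        Transversal _≡ₕ_ (λ i → mem H₁ (i - y)) (map proj₂ (block dir y))
      block-u dir y = subst (Transversal _≡ₕ_ _)
        (sym (map-applyUpTo (λ j → v-index dir y j , u-index dir y j) proj₂ (suc d)))
        (transversal-u dir y)

      h∈H₁ : mem H₁ (+ h)
      h∈H₁ = ⊆-adjoin m Mod-h s {+ h} ∣-refl

      -- The first pair of the first block is absent from the list because a `Zag` sets out from the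
      -- `U`-vertex of that pair.
      zag-blocks : ∀ δ y n →
        (∀ {j} → j < n → Adjᶻ (U , u-index (δ j) (y j) d) (V , v-index (δ (suc j)) (y (suc j)) 0)) →
        ∃ (Zag (u-index (δ 0) (y 0) 0)
             (applyUpTo (λ j → v-index (δ 0) (y 0) (suc j) , u-index (δ 0) (y 0) (suc j)) d ++
               concat (applyUpTo (λ j → block (δ (suc j)) (y (suc j))) n)))
      zag-blocks δ y n link = _ , within ++ᶻ proj₂ (onwards n link)
        where
        within : Zag _ _ (u-index (δ 0) (y 0) d)
        within = zag-applyUpTo (v-index (δ 0) (y 0)) (u-index (δ 0) (y 0))
          (block-vu (δ 0) (y 0)) (block-uv (δ 0) (y 0)) d
        onwards : ∀ n →
          (∀ {j} → j < n → Adjᶻ (U , u-index (δ j) (y j) d) (V , v-index (δ (suc j)) (y (suc j)) 0)) →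
          ∃ (Zag (u-index (δ 0) (y 0) d) (concat (applyUpTo (λ j → block (δ (suc j)) (y (suc j))) n)))
        onwards zero    _    = _ , []
        onwards (suc n) link = _ , zag (link ℕ.z<s) (block-vu (δ 1) (y 1) 0)
          (proj₂ (zag-blocks (δ ∘ suc) (y ∘ suc) n (link ∘ ℕ.s<s)))

      -- As `b + q` vanishes modulo `m`, an edge of type `q` joins the `U`-vertex `b` to v_0 and is
      -- the chord. The condition on `b₁` excludes l = 2.
      close : ∀ {q a₁ b₁ ps e′ a b} (H : Subgroup m) → mem H (+ h) → a₁ ≡ 0ℤ →
        Adjᶻ (V , a₁) (U , b₁) → Zag b₁ ps e′ →
        Conn U V q → (a , b) ∈ˡ (a₁ , b₁) ∷ ps → + m ∣ᶻ b + q → ¬ + m ∣ᶻ b₁ + q →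
        Transversal _≡ₕ_ (λ i → mem H (i - 0ℤ)) (map proj₁ ((a₁ , b₁) ∷ ps)) →
        Transversal _≡ₕ_ (λ i → mem H (i - 0ℤ)) (map proj₂ ((a₁ , b₁) ∷ ps)) →
        Block H U V
      close H h∈ refl first path conn (here refl) m∣ m∤ ta tb = contradiction m∣ m∤
      close {q} {b = b} H h∈ refl first path conn (there ab∈ps) m∣ m∤ ta tb =
        lollipop-block H h∈ first path ab∈ps
          (conn-resp U V (subst (+ m ∣ᶻ_) (((∀ b q → b + q ≡ q - (0ℤ - b)) ∋ solve-∀) b q) m∣) conn)
          (resp ta) (resp tb)
        where
        resp : ∀ {is} → Transversal _≡ₕ_ (λ i → mem H (i - 0ℤ)) is → Transversal _≡ₕ_ (mem H) is
        resp = transversal-resp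
          (λ {i} p → Subgroup.by H p (((∀ i → i - 0ℤ ≡ i) ∋ solve-∀) i))
          (λ {i} p → Subgroup.by H p (((∀ i → i ≡ i - 0ℤ) ∋ solve-∀) i))

    -- The chord is the edge of type `s` from the last vertex of the path to v_0, so l = N; the last
    -- vertex is not u_0 because s is not 0 modulo m.
    closed-block : + m ∣ᶻ + suc d * s → Block H₁ U V
    closed-block m∣ds = close H₁ h∈H₁ refl
      (block-vu true 0ℤ 0)
      (zag-applyUpTo (v-index true 0ℤ) (u-index true 0ℤ) (block-vu true 0ℤ) (block-uv true 0ℤ) d)
      conn-s
      (∈-applyUpTo⁺ (λ j → v-index true 0ℤ j , u-index true 0ℤ j) (ℕ.n<1+n d))
      (subst (+ m ∣ᶻ_) (((∀ d s → (1ℤ + d) * s ≡ 0ℤ + d * s + s) ∋ solve-∀) (+ d) s) m∣ds)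
      (λ m∣s → h∤s (∣-trans h∣m (subst (+ m ∣ᶻ_) (((∀ s → 0ℤ + 0ℤ * s + s ≡ s) ∋ solve-∀) s) m∣s)))
      (block-v true 0ℤ)
      (block-u true 0ℤ)

    private
      -- The displacement between the starts of consecutive blocks: `d` steps of `s` to the last
      -- `U`-vertex, then an edge of type `w`.
      e : ℤ
      e = + d * s + w

    module _ {k : ℕ} (e-index : Index m H₁ e k) where
      private
        H₂ : Subgroup m
        H₂ = adjoin m H₁ e

        start : ℕ → ℤ
        start j = 0ℤ + + j * e

        -- Only the block numbered `k`, the last one, may run backwards: the others must end where
        -- an edge of type `w` leads to the next start.
        direction : Bool → ℕ → Bool
        direction dir j = if does (j ℕ.≟ k) then dir else true

        direction-last : ∀ dir → direction dir k ≡ dir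
        direction-last dir rewrite dec-true (k ℕ.≟ k) refl = refl

        direction-before : ∀ dir {j} → j < k → direction dir j ≡ true
        direction-before dir {j} j<k rewrite dec-false (j ℕ.≟ k) (ℕ.<⇒≢ j<k) = refl

        v-index-0 : ∀ dir y → v-index dir y 0 ≡ y
        v-index-0 true  y = ((∀ y s → y + 0ℤ * s ≡ y) ∋ solve-∀) y s
        v-index-0 false y = ((∀ y s → y + 0ℤ * - s ≡ y) ∋ solve-∀) y s

        link : ∀ dir {j} → j < k →
          Adjᶻ (U , u-index (direction dir j) (start j) d)
               (V , v-index (direction dir (suc j)) (start (suc j)) 0)
        link dir {j} j<k
          rewrite direction-before dir j<k | v-index-0 (direction dir (suc j)) (start (suc j)) =
          subst (Conn U V)
            (((∀ j d s w → w ≡ 0ℤ + (1ℤ + j) * (d * s + w) - (0ℤ + j * (d * s + w) + d * s)) ∋ solve-∀)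
              (+ j) (+ d) s w) conn-w

        -- If `k` is 0, the first block is also the last, so both directions occur. Its first
        -- `U`-vertex has index 0 or `- s`, and `w` is neither 0 nor `s` modulo `m`.
        head-misses : ∀ dir → ¬ + m ∣ᶻ u-index dir (start 0) 0 + w
        head-misses true  m∣ = m∤w
          (subst (+ m ∣ᶻ_) (((∀ e s w → 0ℤ + 0ℤ * e + 0ℤ * s + w ≡ w) ∋ solve-∀) e s w) m∣)
        head-misses false m∣ = m∤w-s
          (subst (+ m ∣ᶻ_) (((∀ e s w → 0ℤ + 0ℤ * e - s + 0ℤ * - s + w ≡ w - s) ∋ solve-∀) e s w) m∣)

      -- The neighbour of v_0 with index `- w` is at position `l` of the last block and gives the
      -- chord.
      open-block : ∀ dir {l} → l < suc d → + m ∣ᶻ u-index dir (start k) l + w → Block H₂ U V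
      open-block dir {l} l<d m∣ = close H₂
        (⊆-adjoin m H₁ e {+ h} h∈H₁)
        (trans (v-index-0 (direction dir 0) (start 0)) (((∀ e → 0ℤ + 0ℤ * e ≡ 0ℤ) ∋ solve-∀) e))
        (block-vu (direction dir 0) (start 0) 0)
        (proj₂ (zag-blocks (direction dir) start k (link dir)))
        conn-w
        (∈-concat⁺′ {vs = block (direction dir k) (start k)}
          (subst (λ δ → (v-index dir (start k) l , u-index dir (start k) l) ∈ˡ block δ (start k))
            (sym (direction-last dir))
            (∈-applyUpTo⁺ (λ j → v-index dir (start k) j , u-index dir (start k) j) l<d))
          (∈-applyUpTo⁺ blocks (ℕ.n<1+n k)))
        m∣
        (head-misses (direction dir 0))
        (transversal-blocks proj₁ block-v)
        (transversal-blocks proj₂ block-u)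
        where
        blocks : ℕ → List (ℤ × ℤ)
        blocks j = block (direction dir j) (start j)
        transversal-blocks : ∀ f →
          (∀ δ y → Transversal _≡ₕ_ (λ i → mem H₁ (i - y)) (map f (block δ y))) →
          Transversal _≡ₕ_ (λ i → mem H₂ (i - 0ℤ)) (map f (concat (applyUpTo blocks (suc k))))
        transversal-blocks f t = subst (Transversal _≡ₕ_ _)
          (trans (cong concat (sym (map-applyUpTo blocks (map f) (suc k))))
            (concat-map (applyUpTo blocks (suc k))))
          (transversal-adjoin m id H₁ e-index (λ {i} {j} → ⊆-adjoin m Mod-h s {i - j}) 0ℤ
            (λ {j} _ → t (direction dir j) (start j)))

      -- Traversed forwards, the last block reaches one half of its coset of ⟨s⟩ modulo m, and
      -- traversed backwards the other half; - w lies in that coset.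
      half-turn-block : + m ∣ᶻ + suc d * s - + h → Block H₂ U V
      half-turn-block m∣ds-h =
        let c , divides f eq = Index.returns e-index in
        reach (+ d - c - f * + suc d) (chord-position {+ d} {s} {w} {+ k} {c} {f} m∣ds-h eq)
        where
        reach : ∀ n → + m ∣ᶻ + k * e + n * s + w → Block H₂ U V
        reach n pos =
          [ (λ (l , l<d , m∣) → open-block true l<d (subst (+ m ∣ᶻ_)
              (((∀ y n s l w → y + n * s + w - (n * s - l * s) ≡ 0ℤ + y + l * s + w) ∋ solve-∀)
                (+ k * e) n s (+ l) w)
              (∣m∣n⇒∣m-n pos m∣)))
          , (λ (l , l<d , m∣) → open-block false l<d (subst (+ m ∣ᶻ_)
              (((∀ y n s l w → y + n * s + w - (n * s + s + l * s) ≡ 0ℤ + y - s + l * - s + w) ∋ solve-∀)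
                (+ k * e) n s (+ l) w)
              (∣m∣n⇒∣m-n pos m∣)))
          ]′ (half-turn {suc d} {s} m∣ds-h n)

  -- `suc d` is the D of the overview; whether D s is 0 or h modulo m selects the construction.
  base-block : ∀ {s w} → Conn U V 0ℤ → Conn U V s → Conn U V w →
    ¬ + h ∣ᶻ s → ¬ + m ∣ᶻ w → ¬ + m ∣ᶻ w - s → Σ[ H ∈ Subgroup m ] Block H U V
  base-block {s} {w} conn-0 conn-s conn-w h∤s m∤w m∤w-s =
    let d , s-index = index m Mod-h s
        H₁ = adjoin m Mod-h s
        k , e-index = index m H₁ (+ d * s + w)
    in
    [ (λ m∣ → H₁ , closed-block conn-0 conn-s conn-w h∤s m∤w m∤w-s s-index m∣)
    , (λ m∣ → adjoin m H₁ (+ d * s + w) ,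
        half-turn-block conn-0 conn-s conn-w h∤s m∤w m∤w-s s-index e-index m∣)
    ]′ (∣h⇒∣m⊎∣m {+ suc d * s} (Index.returns s-index))

-- Choosing elements of S.

∣p∪⁅x⁆∣≤1+∣p∣ : ∀ {n} (p : Subset n) x → ∣ p ∪ ⁅ x ⁆ ∣ ≤ suc ∣ p ∣
∣p∪⁅x⁆∣≤1+∣p∣ (inside  ∷ p) Fin.zero    =
  s≤s (ℕ.m≤n⇒m≤1+n (ℕ.≤-reflexive (cong ∣_∣ (Subset.∪-identityʳ p))))
∣p∪⁅x⁆∣≤1+∣p∣ (outside ∷ p) Fin.zero    = s≤s (ℕ.≤-reflexive (cong ∣_∣ (Subset.∪-identityʳ p)))
∣p∪⁅x⁆∣≤1+∣p∣ (inside  ∷ p) (Fin.suc x) = s≤s (∣p∪⁅x⁆∣≤1+∣p∣ p x)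
∣p∪⁅x⁆∣≤1+∣p∣ (outside ∷ p) (Fin.suc x) = ∣p∪⁅x⁆∣≤1+∣p∣ p x

third-element : ∀ {n} (p : Subset n) → 3 ≤ ∣ p ∣ → ∀ a b → ∃ λ x → x ∈ p × x ≢ a × x ≢ b
third-element p 3≤ a b
  with Fin.any? (λ x → (x ∈? p) ×-dec ¬? (x Fin.≟ a) ×-dec ¬? (x Fin.≟ b))
... | yes found = found
... | no none = contradiction (begin
    3                    ≤⟨ 3≤ ⟩
    ∣ p ∣                ≤⟨ Subset.p⊆q⇒∣p∣≤∣q∣ p⊆ab ⟩
    ∣ ⁅ a ⁆ ∪ ⁅ b ⁆ ∣    ≤⟨ ∣p∪⁅x⁆∣≤1+∣p∣ ⁅ a ⁆ b ⟩
    suc ∣ ⁅ a ⁆ ∣        ≡⟨ cong suc (Subset.∣⁅x⁆∣≡1 a) ⟩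
    2                    ∎) (ℕ.<⇒≱ (ℕ.n<1+n 2))
  where
  open ℕ.≤-Reasoning
  p⊆ab : ∀ {x} → x ∈ p → x ∈ ⁅ a ⁆ ∪ ⁅ b ⁆
  p⊆ab {x} x∈p with x Fin.≟ a | x Fin.≟ b
  ... | yes refl | _        = Subset.x∈p∪q⁺ (inj₁ (Subset.x∈⁅x⁆ a))
  ... | no _     | yes refl = Subset.x∈p∪q⁺ (inj₂ (Subset.x∈⁅x⁆ b))
  ... | no x≢a   | no x≢b   = contradiction (x , x∈p , x≢a , x≢b) none

-- Integers and their residues.

module _ {m : ℕ} .{{_ : NonZero m}} where

  abstract
    residue : ℤ → Fin m
    residue i = fromℕ< (n%ℕd<d i m)

    toℕ-residue : ∀ i → + m ∣ᶻ i - + toℕ (residue i)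
    toℕ-residue i = divides (i /ℕ m) (trans
      (cong₂ (λ x y → x - + y) (a≡a%ℕn+[a/ℕn]*n i m) (toℕ-fromℕ< (n%ℕd<d i m)))
      (((∀ r k → r + k - r ≡ k) ∋ solve-∀) (+ (i %ℕ m)) (i /ℕ m * + m)))

    residue-toℕ : ∀ f → residue (+ toℕ f) ≡ f
    residue-toℕ f = toℕ-injective (trans (toℕ-fromℕ< (n%ℕd<d (+ toℕ f) m)) (m<n⇒m%n≡m (toℕ<n f)))

    mod≡residue : ∀ n → n mod m ≡ residue (+ n)
    mod≡residue n = toℕ-injective (trans (toℕ-fromℕ< _) (sym (toℕ-fromℕ< (n%ℕd<d (+ n) m))))

  -- The difference is less than `m` in absolute value, so the only multiple it can be is 0.
  <-unique : ∀ {a b} → a < m → b < m → + m ∣ᶻ + a - + b → a ≡ b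
  <-unique {a} {b} a<m b<m d with abs (+ a - + b) in eq | ∣⇒∣ᵤ d | bound a<m b<m
    where
    bound : ∀ {a b} → a < m → b < m → abs (+ a - + b) < m
    bound {a} {b} a<m b<m = subst (_< m) (cong abs (sym (ℤ.m-n≡m⊖n a b)))
      (ℕ.≤-<-trans (ℤ.∣m⊝n∣≤m⊔n a b) (ℕ.⊔-lub a<m b<m))
  ... | zero  | _  | _ = ℤ.+-injective (ℤ.i-j≡0⇒i≡j (+ a) (+ b) (ℤ.∣i∣≡0⇒i≡0 eq))
  ... | suc _ | d′ | b = contradiction d′ (ℕ.>⇒∤ b)

  residue-cong : ∀ {i j} → + m ∣ᶻ i - j → residue i ≡ residue j
  residue-cong {i} {j} d = toℕ-injective (<-unique (toℕ<n (residue i)) (toℕ<n (residue j))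
    (subst (+ m ∣ᶻ_)
      (((∀ i j x y → i - j - (i - x) + (j - y) ≡ x - y) ∋ solve-∀)
        i j (+ toℕ (residue i)) (+ toℕ (residue j)))
      (∣m∣n⇒∣m+n (∣m∣n⇒∣m-n d (toℕ-residue i)) (toℕ-residue j))))

  residue-injective : ∀ i j → residue i ≡ residue j → + m ∣ᶻ i - j
  residue-injective i j eq = subst (+ m ∣ᶻ_)
    (trans (cong (λ x → i - + toℕ x - (j - + toℕ (residue j))) eq)
      (((∀ i j x → i - x - (j - x) ≡ i - j) ∋ solve-∀) i j (+ toℕ (residue j))))
    (∣m∣n⇒∣m-n (toℕ-residue i) (toℕ-residue j))

  residue-+ : ∀ i j → residue i ⊕ residue j ≡ residue (i + j)
  residue-+ i j = trans (mod≡residue (toℕ (residue i) ℕ.+ toℕ (residue j))) (residue-cong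
    (subst (+ m ∣ᶻ_)
      (trans (((∀ i j x y → - (i - x) - (j - y) ≡ x + y - (i + j)) ∋ solve-∀)
          i j (+ toℕ (residue i)) (+ toℕ (residue j)))
        (cong (_- (i + j)) (sym (ℤ.pos-+ (toℕ (residue i)) (toℕ (residue j))))))
      (∣m∣n⇒∣m-n (∣m⇒∣-m (toℕ-residue i)) (toℕ-residue j))))

  residue-step : ∀ i j → residue i ⊕ residue (j - i) ≡ residue j
  residue-step i j = trans (residue-+ i (j - i))
    (cong residue (((∀ i j → i + (j - i) ≡ j) ∋ solve-∀) i j))

  residue-neg : ∀ i → ⊖ residue i ≡ residue (- i)
  residue-neg i = trans (mod≡residue (m ℕ.∸ x)) (residue-cong
    (subst (+ m ∣ᶻ_)
      (trans (((∀ m x i → m + (i - x) ≡ m - x - - i) ∋ solve-∀) (+ m) (+ x) i)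
        (cong (_- - i) (trans (ℤ.m-n≡m⊖n m x) (ℤ.⊖-≥ (ℕ.<⇒≤ (toℕ<n (residue i)))))))
      (∣m∣n⇒∣m+n ∣-refl (toℕ-residue i))))
    where
    x : ℕ
    x = toℕ (residue i)

-- The bicirculant with integer indices.

module _ (m : ℕ) .{{_ : NonZero m}} (R S T : Subset m) (isB : IsBicirculant m R S T) where

  open IsBicirculant isB

  -- Types are directed: read from `V` to `U`, an edge given by `S` has the negated type.
  Conn : Side → Side → ℤ → Set
  Conn U U i = residue i ∈ R
  Conn U V i = residue i ∈ S
  Conn V U i = residue (- i) ∈ S
  Conn V V i = residue i ∈ T

  Conn? : ∀ s t i → Dec (Conn s t i)
  Conn? U U i = residue i ∈? R
  Conn? U V i = residue i ∈? S
  Conn? V U i = residue (- i) ∈? S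
  Conn? V V i = residue i ∈? T

  conn-resp : ∀ s t {i j} → + m ∣ᶻ i - j → Conn s t i → Conn s t j
  conn-resp U U {i} {j} d = subst (_∈ R) (residue-cong d)
  conn-resp U V {i} {j} d = subst (_∈ S) (residue-cong d)
  conn-resp V U {i} {j} d = subst (_∈ S) (residue-cong
    (subst (+ m ∣ᶻ_) (((∀ i j → - (i - j) ≡ - i - - j) ∋ solve-∀) i j) (∣m⇒∣-m d)))
  conn-resp V V {i} {j} d = subst (_∈ T) (residue-cong d)

  conn-sym : ∀ s t {i} → Conn s t i → Conn t s (- i)
  conn-sym U U {i} p = subst (_∈ R) (residue-neg i) (Equivalence.to (R≡-R (residue i)) p)
  conn-sym U V {i} p = subst (λ j → residue j ∈ S) (sym (ℤ.neg-involutive i)) p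
  conn-sym V U {i} p = p
  conn-sym V V {i} p = subst (_∈ T) (residue-neg i) (Equivalence.to (T≡-T (residue i)) p)

  vertex : Side × ℤ → BVertex m
  vertex (U , i) = u (residue i)
  vertex (V , i) = v (residue i)

  position : BVertex m → Side × ℤ
  position (u f) = U , + toℕ f
  position (v f) = V , + toℕ f

  conn⇒adj : ∀ {s t} i j → Conn s t (j - i) →
    SymClosure (BEdge m R S T) (vertex (s , i)) (vertex (t , j))
  conn⇒adj {U} {U} i j p = fwd (subst (BEdge m R S T _ ∘ u) (residue-step i j) (uu (residue i) p))
  conn⇒adj {U} {V} i j p = fwd (subst (BEdge m R S T _ ∘ v) (residue-step i j) (uv (residue i) p))
  conn⇒adj {V} {U} i j p = bwd (subst (BEdge m R S T _ ∘ v)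
    (trans (cong (λ k → residue j ⊕ residue k) (((∀ i j → - (j - i) ≡ i - j) ∋ solve-∀) i j))
      (residue-step j i))
    (uv (residue j) p))
  conn⇒adj {V} {V} i j p = fwd (subst (BEdge m R S T _ ∘ v) (residue-step i j) (vv (residue i) p))

  -- Connectivity and edge types.

  module _ (H : Subgroup m)
    (generators : ∀ s t (f : Fin m) → Conn s t (+ toℕ f) → mem H (+ toℕ f)) where

    private
      index-of : BVertex m → ℤ
      index-of = proj₂ ∘ position

      toℕ-⊕ : ∀ (i j : Fin m) → mem H (+ toℕ j) → mem H (+ toℕ (i ⊕ j) - + toℕ i)
      toℕ-⊕ i j p = Subgroup.by H (Subgroup.sub-mem H p (multiple-mem H congruent))
        (((∀ i j k → j - (i + j - k) ≡ k - i) ∋ solve-∀) (+ toℕ i) (+ toℕ j) (+ toℕ (i ⊕ j)))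
        where
        congruent : + m ∣ᶻ + toℕ i + + toℕ j - + toℕ (i ⊕ j)
        congruent = subst (λ k → + m ∣ᶻ + toℕ i + + toℕ j - + toℕ k)
          (sym (trans (cong₂ _⊕_ (sym (residue-toℕ i)) (sym (residue-toℕ j)))
            (residue-+ (+ toℕ i) (+ toℕ j))))
          (toℕ-residue (+ toℕ i + + toℕ j))

      at : ∀ {X : Subset m} {f} → f ∈ X → residue (+ toℕ f) ∈ X
      at {X} {f} = subst (_∈ X) (sym (residue-toℕ f))

      edge-mem : ∀ {x y} → BEdge m R S T x y → mem H (index-of y - index-of x)
      edge-mem (uu i {j} p) = toℕ-⊕ i j (generators U U j (at p))
      edge-mem (vv i {j} p) = toℕ-⊕ i j (generators V V j (at p))
      edge-mem (uv i {j} p) = toℕ-⊕ i j (generators U V j (at p))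

    -- Every edge changes the index by plus or minus its type modulo `m`, and `H` contains all
    -- types.
    reachable-mem : ∀ {x y} → Star (SymClosure (BEdge m R S T)) x y →
      mem H (index-of y - index-of x)
    reachable-mem {x} ε = Subgroup.by H (Subgroup.0-mem H) (sym (ℤ.+-inverseʳ (index-of x)))
    reachable-mem {x} {z} (_◅_ {j = y} (fwd e) es) =
      Subgroup.by H (Subgroup.+-mem H (edge-mem e) (reachable-mem es))
        (((∀ x y z → (y - x) + (z - y) ≡ z - x) ∋ solve-∀) (index-of x) (index-of y) (index-of z))
    reachable-mem {x} {z} (_◅_ {j = y} (bwd e) es) =
      Subgroup.by H (Subgroup.sub-mem H (reachable-mem es) (edge-mem e))
        (((∀ x y z → (z - y) - (x - y) ≡ z - x) ∋ solve-∀) (index-of x) (index-of y) (index-of z))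

  -- The Hamiltonian cycle.

  module _ (connected : Connected (B m R S T isB)) (2∣m : 2 ∣ m) (4≤m : 4 ≤ m) (3≤∣S∣ : 3 ≤ ∣ S ∣)
    (half∈R : half m ∈ R) (half∈T : half m ∈ T) where

    private
      h : ℕ
      h = m / 2

      instance
        h≢0 : NonZero h
        h≢0 = ℕ.>-nonZero (ℕ.n≢0⇒n>0 λ h≡0 → ℕ.<⇒≢ (ℕ.≤-trans (s≤s z≤n) 4≤m)
          (trans (cong (ℕ._* 2) (sym h≡0)) (m/n*n≡m 2∣m)))

      m≡h+h : + m ≡ + h + + h
      m≡h+h = cong +_ (trans (sym (m/n*n≡m 2∣m))
        (trans (ℕ.*-comm h 2) (cong (h ℕ.+_) (ℕ.+-identityʳ h))))

      conn-rung : ∀ s → Conn s s (+ h)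
      conn-rung U = subst (_∈ R) (mod≡residue h) half∈R
      conn-rung V = subst (_∈ T) (mod≡residue h) half∈T

      open Core m h m≡h+h Conn conn-resp conn-sym conn-rung

      first-block : Σ[ H ∈ Subgroup m ] Block H U V
      first-block =
        -- Only `s` has to avoid m/2; `w` may be equal to it.
        let s , s∈S , s≢0 , s≢half = third-element S 3≤∣S∣ 0ₘ (half m)
            w , w∈S , w≢0 , w≢s    = third-element S 3≤∣S∣ 0ₘ s
        in base-block {+ toℕ s} {+ toℕ w}
          (subst (_∈ S) (mod≡residue 0) 0∈S)
          (subst (_∈ S) (sym (residue-toℕ s)) s∈S)
          (subst (_∈ S) (sym (residue-toℕ w)) w∈S)
          (λ h∣s → [ s≢0 ∘ is-0 s , s≢half ∘ is-half s ]′ (∣h⇒∣m⊎∣m h∣s))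
          (w≢0 ∘ is-0 w)
          (λ m∣ → w≢s (trans (sym (residue-toℕ w)) (trans (residue-cong m∣) (residue-toℕ s))))
        where
        is-0 : ∀ f → + m ∣ᶻ + toℕ f → f ≡ 0ₘ
        is-0 f m∣ = trans (sym (residue-toℕ f)) (trans
          (residue-cong (subst (+ m ∣ᶻ_) (((∀ i → i ≡ i - 0ℤ) ∋ solve-∀) (+ toℕ f)) m∣))
          (sym (mod≡residue 0)))
        is-half : ∀ f → + m ∣ᶻ + toℕ f - + h → f ≡ half m
        is-half f m∣ = trans (sym (residue-toℕ f)) (trans (residue-cong m∣) (sym (mod≡residue h)))

      -- Candidates that are not edge types are skipped, so the list may run over all sides and
      -- residues.
      grow-all : ∀ (gs : List (Side × Side × ℤ)) {H} → Block H U V →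
        Σ[ H′ ∈ Subgroup m ] (∀ {i} → mem H i → mem H′ i) ×
          All (λ (s , t , g) → Conn s t g → mem H′ g) gs × Block H′ U V
      grow-all [] {H} b = H , id , [] , b
      grow-all ((s , t , g) ∷ gs) {H} b with Conn? s t g
      ... | no ¬c = let H′ , H⊆H′ , all , b′ = grow-all gs b in
        H′ , H⊆H′ , (λ c → contradiction c ¬c) ∷ all , b′
      ... | yes c =
        let H₁ , H⊆H₁ , g∈H₁ , b₁ = grow s t c b
            H₂ , H₁⊆H₂ , all , b₂ = grow-all gs b₁
        in H₂ , (λ {i} p → H₁⊆H₂ {i} (H⊆H₁ {i} p)) , (λ _ → H₁⊆H₂ {g} g∈H₁) ∷ all , b₂

      sides : List Side
      sides = U ∷ V ∷ []

      all-sides : ∀ s → s ∈ˡ sides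
      all-sides U = here refl
      all-sides V = there (here refl)

      generators : List (Side × Side × ℤ)
      generators = cartesianProduct sides
        (cartesianProduct sides (map (λ (f : Fin m) → + toℕ f) (allFin m)))

      spanning-block : Σ[ H ∈ Subgroup m ] (∀ f → mem H (+ toℕ f)) × Block H U V
      spanning-block =
        let H , _ , all , b = grow-all generators (proj₂ first-block) in
        H ,
        (λ f → Subgroup.by H
          (Subgroup.+-mem H
            (reachable-mem H (λ s t f → All.lookup all (∈-cartesianProduct⁺ (all-sides s)
                (∈-cartesianProduct⁺ (all-sides t) (∈-map⁺ (λ (f : Fin m) → + toℕ f) (∈-allFin f)))))
              -- The vertices `u f` suffice, since their indices run through all residues.
              (connected (u 0ₘ) (u f)))
            (multiple-mem H (subst (+ m ∣ᶻ_) 0≡ (∣m⇒∣-m (toℕ-residue 0ℤ)))))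
          (((∀ i z → i - z + z ≡ i) ∋ solve-∀) (+ toℕ f) (+ toℕ (0ₘ {m})))) ,
        b
        where
        0≡ : - (0ℤ - + toℕ (residue 0ℤ)) ≡ + toℕ (0ₘ {m})
        0≡ = trans (((∀ i → - (0ℤ - i) ≡ i) ∋ solve-∀) (+ toℕ (residue 0ℤ)))
          (cong (λ f → + toℕ f) (sym (mod≡residue 0)))

      vertex-injective : ∀ {x y} → vertex x ≡ vertex y → x ≈ᵥ y
      vertex-injective {U , i} {U , j} eq = same (residue-injective i j (u-injective eq))
        where
        u-injective : ∀ {i j : Fin m} → u i ≡ u j → i ≡ j
        u-injective refl = refl
      vertex-injective {V , i} {V , j} eq = same (residue-injective i j (v-injective eq))
        where
        v-injective : ∀ {i j : Fin m} → v i ≡ v j → i ≡ j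
        v-injective refl = refl

      vertex-cong : ∀ {x y} → x ≈ᵥ y → vertex x ≡ vertex y
      vertex-cong (same {U} d) = cong u (residue-cong d)
      vertex-cong (same {V} d) = cong v (residue-cong d)

      vertex-position : ∀ x → vertex (position x) ≡ x
      vertex-position (u f) = cong u (residue-toℕ f)
      vertex-position (v f) = cong v (residue-toℕ f)

      linked : ∀ {x y ys} → Walk x ys y →
        Linked (SymClosure (BEdge m R S T)) (vertex x ∷ map vertex ys ∷ʳ vertex y)
      linked {_ , i} {_ , j} [ e ] = conn⇒adj i j e ∷ [-]
      linked {_ , i} (_∷_ {y = _ , j} e w) = conn⇒adj i j e ∷ linked w

      -- The transversal yields both uniqueness and covering. The displayed vertices, two on either
      -- side of `A`, guarantee the length of a cycle.
      spans⇒hamiltonian : ∀ H → (∀ f → mem H (+ toℕ f)) → ∀ x y A {z w Z} →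
        Spans H (x ∷ y ∷ A ++ z ∷ w ∷ Z) → Hamiltonian (B m R S T isB)
      spans⇒hamiltonian H everything x y A {z} {w} {Z} (walk , transversal) =
        vertex x , map vertex xs , (long A , unique , linked walk) , covers
        where
        xs : List Vertexᶻ
        xs = y ∷ A ++ z ∷ w ∷ Z
        long : ∀ A → 3 ≤ length (map vertex (x ∷ y ∷ A ++ z ∷ w ∷ Z))
        long []      = s≤s (s≤s (s≤s z≤n))
        long (_ ∷ _) = s≤s (s≤s (s≤s z≤n))
        unique : Unique (map vertex (x ∷ xs))
        unique = AllPairs.map⁺
          (AllPairs.map (λ x≁y → x≁y ∘ vertex-injective) (Transversal.distinct transversal))
        mem-position : ∀ y → mem H (proj₂ (position y))
        mem-position (u f) = everything f
        mem-position (v f) = everything f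
        covers : ∀ y → y ∈ˡ map vertex (x ∷ xs)
        covers y = Any.map⁺ {f = vertex} (Any.map
          (λ eq → trans (sym (vertex-position y)) (vertex-cong eq))
          (Transversal.complete transversal {position y} (mem-position y)))

    hamiltonian : Hamiltonian (B m R S T isB)
    hamiltonian = let H , everything , b = spanning-block in
      spans⇒hamiltonian H everything _ _ (Block.A₁ b) (Block.spans b)

theorem1p4 : (m : ℕ) .{{_ : NonZero m}} (R S T : Subset m) (isB : IsBicirculant m R S T) →
    Connected (B m R S T isB) →
    2 ∣ m → 4 ≤ m → 3 ≤ ∣ S ∣ →
    half m ∈ R → half m ∈ T →
    Hamiltonian (B m R S T isB)
theorem1p4 = hamiltonian
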